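{- Let $n\ge2$, let $I$ be an ideal of $\Phi_{A_{n-1}}$ such that $I^c$ is full, let $\mathcal{A}_I=\{\{x\in\mathbb{R}^n:x_i-x_j=0\}: e_i-e_j\in I^c\}$, let $A^{(1)}|\dots|A^{(r)}$ be the partition of $[n]$ in accordance with $I$, and let $R^{(u)}=\{v\in\{u+1,\dots,r\}: s_I(A^{(u)})\cap s_I(A^{(v)})\ne\emptyset\}$. Then for every odd prime $p$, $$\bar\chi_{\mathcal{A}_I}(p,t)=\frac1p\sum_{(a^{(u)}_s)}\ \prod_{u=1}^r\binom{\#A^{(u)}}{a^{(u)}_1,\dots,a^{(u)}_p}\ \cdot\ t^{\sum_{u=1}^r\sum_{s=1}^p\left(\binom{a^{(u)}_s}{2}+a^{(u)}_s\sum_{v\in R^{(u)}}a^{(v)}_s\right)},$$ where the sum runs over all families of nonnegative integers $(a^{(u)}_s)_{u\in[r],\,s\in[p]}$ with $a^{(u)}_1+\dots+a^{(u)}_p=\#A^{(u)}$ for each $u\in[r]$.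
   Context: $\Phi^+_{A_{n-1}}=\{e_i-e_j:1\le i<j\le n\}$ with simple roots $e_i-e_{i+1}$, $i\in[n-1]$. The partial order $\preceq$: $e_i-e_j\preceq e_{i'}-e_{j'}$ iff $i'\le i$ and $j\le j'$. An ideal is a subset $I\subseteq\Phi^+_{A_{n-1}}$ with $u\in I$, $u\preceq v\Rightarrow v\in I$; $I^c=\Phi^+_{A_{n-1}}\setminus I$. $I^c$ is full if it contains every simple root. Let $e_{i_1}-e_{j_1},\dots,e_{i_k}-e_{j_k}$ be the maximal elements of $I^c$. The signature of $u\in[n]$ is $s_I(u)=\{l\in[k]: i_l\le u\le j_l\}$. The partition of $[n]$ in accordance with $I$ is the partition $A^{(1)}|\dots|A^{(r)}$ into the maximal nonempty subsets on which $s_I$ is constant, indexed so that $\min A^{(1)}<\dots<\min A^{(r)}$; $s_I(A^{(u)})$ is the common value of $s_I$ on $A^{(u)}$. For a subarrangement $\mathcal{B}$, $\mathrm{r}(\mathcal{B})=n-\dim\bigcap\mathcal{B}$ (with $\bigcap\emptyset=\mathbb{R}^n$). The coboundary polynomial is $\bar\chi_{\mathcal{A}}(q,t)=\sum_{\mathcal{B}\subseteq\mathcal{A}}q^{\mathrm{r}(\mathcal{A})-\mathrm{r}(\mathcal{B})}(t-1)^{\#\mathcal{B}}$. -}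

module Defs where

open import Algebra.Bundles using (CommutativeRing)
open import Algebra.Bundles.Raw using (RawRing)
import Algebra.Definitions.RawSemiring as RawSemiringDefs
import Algebra.Properties.CommutativeMonoid.Sum as CommutativeMonoidSum
import Algebra.Properties.AbelianGroup as AbelianGroupProperties
import Algebra.Properties.CommutativeSemigroup as CommutativeSemigroupProperties
import Algebra.Properties.Ring as RingProperties
import Algebra.Properties.Group as GroupProperties
open import Data.Bool.Base using (if_then_else_)
open import Data.Fin.Base as Fin using (Fin; zero; suc; toℕ; punchIn; punchOut)
open import Data.Fin.Properties as FinP using (punchInᵢ≢i; punchIn-punchOut; punchOut-punchIn; punchOut-cong)
open import Data.Fin.Subset as Subset using (Subset; inside; outside; _∈_; _⊆_; _∩_; ⊤; Nonempty)
open import Data.Fin.Subset.Properties using (nonempty?; _∈?_)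
import Data.Integer.Base as ℤ
open import Data.List.Base as List using (List; []; _∷_; _++_; foldr; length; lookup; filter; mapMaybe; allFin; cartesianProduct; cartesianProductWith; concatMap; upTo)
open import Data.List.Membership.Propositional using () renaming (_∈_ to _∈ₗ_)
open import Data.List.Membership.Propositional.Properties using (∈-map⁺; ∈-map⁻; ∈-filter⁺; ∈-filter⁻; ∈-allFin; ∈-cartesianProduct⁺)
import Data.List.Relation.Unary.All as All
import Data.List.Relation.Unary.All.Properties as AllP
import Data.List.Relation.Unary.Any as Any
open Any using (here; there)
import Data.List.Relation.Unary.Any.Properties as AnyP
open import Data.Maybe.Base using (Maybe; just; nothing)
import Data.Maybe.Relation.Unary.Any as MAny
open import Data.Nat.Base as ℕ using (ℕ; zero; suc; _∸_; _!)
open import Data.Nat.ListAction using (product)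
open import Data.Nat.ListAction.Properties using (product≢0)
import Data.Nat.Properties as ℕP
open import Data.Product using (_×_; _,_; ∃; ∃-syntax; proj₁; proj₂)
import Data.Rational.Base as ℚ
import Data.Rational.Properties as ℚP
open import Data.Vec.Base as Vec using (Vec; []; _∷_; tabulate)
import Data.Vec.Functional as Vector
open Vector using (Vector)
open import Function.Base using (_∘_)
open import Level using (0ℓ)
open import Relation.Binary.Construct.Closure.Equivalence as EqC using (EqClosure)
import Relation.Binary.Construct.Closure.ReflexiveTransitive as Star
open Star using (_◅_; _◅◅_)
open import Relation.Binary.Construct.Closure.Symmetric using (bwd)
open import Relation.Nullary.Decidable using (Dec; yes; no; does; map′; _×-dec_; _→-dec_; ¬?)
open import Relation.Nullary.Negation using (¬_; contradiction)
open import Relation.Unary using (Pred; Decidable)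
open import Relation.Unary.Properties using (∁?)
open import Relation.Binary.PropositionalEquality using (_≡_; _≢_; refl; sym; trans; cong; subst)

------------------------------------------------------------------------
-- Connected components of the graph on Fin n with a given list of edges

record Components {n} (edges : List (Fin n × Fin n)) (d : ℕ) : Set where
  field
    class     : Fin n → Fin d
    rep       : Fin d → Fin n
    class-rep : ∀ k → class (rep k) ≡ k
    respects  : ∀ {i j} → (i , j) ∈ₗ edges → class i ≡ class j
    connected : ∀ u → EqClosure (λ i j → (i , j) ∈ₗ edges) u (rep (class u))

addInner : ∀ {n d i j} {edges : List (Fin n × Fin n)} (G : Components edges d) →
           Components.class G i ≡ Components.class G j →
           Components ((i , j) ∷ edges) d
addInner G ci≡cj = record
  { class     = class
  ; rep       = rep
  ; class-rep = class-rep
  ; respects  = λ { (here refl) → ci≡cj ; (there e) → respects e }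
  ; connected = EqC.map there ∘ connected
  }
  where open Components G

addBridge : ∀ {n d i j} {edges : List (Fin n × Fin n)} (G : Components edges (suc d)) →
            Components.class G i ≢ Components.class G j →
            Components ((i , j) ∷ edges) d
addBridge {n} {d} {i} {j} {edges} G ci≢cj = record
  { class     = λ u → merge (class u)
  ; rep       = rep ∘ punchIn (class j)
  ; class-rep = λ k → trans (cong merge (class-rep (punchIn (class j) k))) (merge-punchIn k)
  ; respects  = λ { (here refl) → sym merge-ends ; (there e) → cong merge (respects e) }
  ; connected = λ u → old u ◅◅ step (class u)
  }
  where
  open Components G

  _~_ : Fin n → Fin n → Set
  u ~ v = (u , v) ∈ₗ ((i , j) ∷ edges)

  merge : Fin (suc d) → Fin d
  merge k with class j FinP.≟ k
  ... | yes _    = punchOut (ci≢cj ∘ sym)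
  ... | no  cj≢k = punchOut cj≢k

  merge-punchIn : ∀ k → merge (punchIn (class j) k) ≡ k
  merge-punchIn k with class j FinP.≟ punchIn (class j) k
  ... | yes eq = contradiction (sym eq) (punchInᵢ≢i (class j) k)
  ... | no  _  = trans (punchOut-cong (class j) refl) (punchOut-punchIn (class j))

  merge-ends : merge (class j) ≡ merge (class i)
  merge-ends with class j FinP.≟ class j | class j FinP.≟ class i
  ... | no ne | _     = contradiction refl ne
  ... | _     | yes e = contradiction (sym e) ci≢cj
  ... | yes _ | no _  = punchOut-cong (class j) refl

  old : ∀ u → EqClosure _~_ u (rep (class u))
  old u = EqC.map there (connected u)

  step : ∀ k → EqClosure _~_ (rep k) (rep (punchIn (class j) (merge k)))
  step k with class j FinP.≟ k
  ... | yes refl = subst (EqClosure _~_ (rep (class j)) ∘ rep)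
                     (sym (punchIn-punchOut (ci≢cj ∘ sym)))
                     (EqC.symmetric _~_ (old j) ◅◅ bwd (here refl) ◅ old i)
  ... | no cj≢k  = subst (EqClosure _~_ (rep k) ∘ rep) (sym (punchIn-punchOut cj≢k)) Star.ε

components : ∀ {n} (edges : List (Fin n × Fin n)) → ∃[ d ] Components edges d
components {n} [] = n , record
  { class = λ u → u ; rep = λ u → u ; class-rep = λ _ → refl
  ; respects = λ () ; connected = λ _ → Star.ε }
components ((i , j) ∷ edges) with components edges
... | d , G with Components.class G i FinP.≟ Components.class G j
components ((i , j) ∷ edges) | d , G     | yes ci≡cj = d , addInner G ci≡cj
components ((i , j) ∷ edges) | suc d , G | no  ci≢cj = d , addBridge G ci≢cj
components ((i , j) ∷ edges) | zero , G  | no  _     with () ← Components.class G i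

------------------------------------------------------------------------
-- Bases and dimensions; solution sets of systems of equations xᵢ - xⱼ = 0

module LinearAlgebra (F : CommutativeRing 0ℓ 0ℓ) where
  open CommutativeRing F hiding (zero) renaming (refl to ≈-refl; sym to ≈-sym; trans to ≈-trans)
  open CommutativeMonoidSum +-commutativeMonoid using (sum-syntax)

  record HasDimension {n} (V : Pred (Vector Carrier n) 0ℓ) (d : ℕ) : Set where
    field
      basis       : Fin d → Vector Carrier n
      basis∈V     : ∀ k → V (basis k)
      independent : ∀ (c : Vector Carrier d) →
                    (∀ u → ∑[ k < d ] (c k * basis k u) ≈ 0#) → ∀ k → c k ≈ 0#
      spanning    : ∀ x → V x →
                    ∃ λ (c : Vector Carrier d) → ∀ u → ∑[ k < d ] (c k * basis k u) ≈ x u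

  Hyperplane : ∀ {n} → Fin n → Fin n → Pred (Vector Carrier n) 0ℓ
  Hyperplane i j x = x i - x j ≈ 0#

  Equations : ∀ {n} → List (Fin n × Fin n) → Pred (Vector Carrier n) 0ℓ
  Equations edges x = ∀ {i j} → (i , j) ∈ₗ edges → Hyperplane i j x

  open GroupProperties +-group using () renaming (x∙y⁻¹≈ε⇒x≈y to difference)

  private
    δ : ∀ {d} → Fin d → Fin d → Carrier
    δ k l = if does (k FinP.≟ l) then 1# else 0#

    sum-zeros : ∀ {d} (c : Vector Carrier d) → ∑[ k < _ ] (c k * 0#) ≈ 0#
    sum-zeros {zero}  c = ≈-refl
    sum-zeros {suc d} c = ≈-trans (+-cong (zeroʳ (c zero)) (sum-zeros (c ∘ suc))) (+-identityˡ _)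

    sum-δ : ∀ {d} (c : Vector Carrier d) l → ∑[ k < _ ] (c k * δ l k) ≈ c l
    sum-δ c zero    = ≈-trans (+-cong (*-identityʳ (c zero)) (sum-zeros (c ∘ suc))) (+-identityʳ _)
    sum-δ c (suc l) = ≈-trans (+-cong (zeroʳ (c zero)) (sum-δ (c ∘ suc) l)) (+-identityˡ _)

  dimension-Equations : ∀ {n d} {edges : List (Fin n × Fin n)} →
                        Components edges d → HasDimension (Equations edges) d
  dimension-Equations {edges = edges} G = record
    { basis       = λ k u → δ (class u) k
    ; basis∈V     = λ k {i} {j} e →
        ≈-trans (+-congʳ (reflexive (cong (λ l → δ l k) (respects e))))
                (-‿inverseʳ (δ (class j) k))
    ; independent = λ c eq k → ≈-trans (≈-sym (sum-δ c k))
        (subst (λ l → ∑[ m < _ ] (c m * δ l m) ≈ 0#) (class-rep k) (eq (rep k)))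
    ; spanning    = λ x x∈V → x ∘ rep , λ u →
        ≈-trans (sum-δ (x ∘ rep) (class u)) (≈-sym (along x x∈V (connected u)))
    }
    where
    open Components G
    along : ∀ x → Equations edges x → ∀ {u v} →
            EqClosure (λ i j → (i , j) ∈ₗ edges) u v → x u ≈ x v
    along x x∈V = EqC.gfold isEquivalence x (λ e → difference _ _ (x∈V e))

  HasDimension-resp : ∀ {n d} {V W : Pred (Vector Carrier n) 0ℓ} →
                      (∀ x → V x → W x) → (∀ x → W x → V x) →
                      HasDimension V d → HasDimension W d
  HasDimension-resp V⊆W W⊆V D = record
    { basis = basis ; basis∈V = λ k → V⊆W _ (basis∈V k)
    ; independent = independent ; spanning = λ x → spanning x ∘ W⊆V x }
    where open HasDimension D

------------------------------------------------------------------------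
-- The real numbers: Cauchy sequences of rationals with explicit moduli of
-- convergence, up to the equivalence relation _≈_

module Differences {c ℓ} (R : CommutativeRing c ℓ) where
  open CommutativeRing R renaming (refl to ≈-refl; sym to ≈-sym; trans to ≈-trans)
  open AbelianGroupProperties +-abelianGroup
    using (//-rightDividesˡ; ⁻¹-∙-comm; ⁻¹-anti-homo‿-)
  open RingProperties ring using (x[y-z]≈xy-xz)
  open CommutativeSemigroupProperties +-commutativeSemigroup using (interchange)

  split : ∀ a b → a ≈ (a - b) + b
  split a b = ≈-sym (//-rightDividesˡ b a)

  neg-diff : ∀ a b → - a - - b ≈ - (a - b)
  neg-diff a b = ⁻¹-∙-comm a (- b)

  swap-diff : ∀ a b → a - b ≈ - (b - a)
  swap-diff a b = ≈-sym (⁻¹-anti-homo‿- b a)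

  sum-diff : ∀ a b c d → (a + b) - (c + d) ≈ (a - c) + (b - d)
  sum-diff a b c d =
    ≈-trans (+-congˡ (≈-sym (⁻¹-∙-comm c d))) (interchange a b (- c) (- d))

  chain-diff : ∀ a b c → a - c ≈ (a - b) + (b - c)
  chain-diff a b c = ≈-trans (+-congʳ (split a b)) (+-assoc (a - b) b (- c))

  prod-diff : ∀ a b c d → a * b - c * d ≈ a * (b - d) + d * (a - c)
  prod-diff a b c d = ≈-trans (chain-diff (a * b) (a * d) (c * d))
    (+-cong (≈-sym (x[y-z]≈xy-xz a b d))
            (≈-trans (+-cong (*-comm a d) (-‿cong (*-comm c d))) (≈-sym (x[y-z]≈xy-xz d a c))))

module Reals where
  open import Data.Rational.Base using (ℚ; 0ℚ; 1ℚ; ½; _+_; _*_; _-_; -_; _<_; ∣_∣)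
  open ℚP.≤-Reasoning
  open Differences ℚP.+-*-commutativeRing

  record ℝ : Set where
    constructor mkℝ
    field
      seq    : ℕ → ℚ
      cauchy : ∀ ε → 0ℚ < ε →
               ∃[ N ] (∀ m n → N ℕ.≤ m → N ℕ.≤ n → ∣ seq m - seq n ∣ < ε)

  open ℝ

  infix 4 _≈_
  record _≈_ (x y : ℝ) : Set where
    constructor mk≈
    field
      null : ∀ ε → 0ℚ < ε →
             ∃[ N ] (∀ n → N ℕ.≤ n → ∣ seq x n - seq y n ∣ < ε)

  open _≈_

  private
    half : ∀ {ε} → 0ℚ < ε → 0ℚ < ½ * ε
    half {ε} 0<ε = ℚP.positive⁻¹ (½ * ε) {{ℚP.pos*pos⇒pos ½ ε {{ℚ.positive 0<ε}}}}

    halves : ∀ ε → ½ * ε + ½ * ε ≡ ε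
    halves ε = trans (sym (ℚP.*-distribʳ-+ ε ½ ½)) (ℚP.*-identityˡ ε)

    +-small : ∀ {ε a b} → ∣ a ∣ < ½ * ε → ∣ b ∣ < ½ * ε → ∣ a + b ∣ < ε
    +-small {ε} {a} {b} a< b< = begin-strict
      ∣ a + b ∣      ≤⟨ ℚP.∣p+q∣≤∣p∣+∣q∣ a b ⟩
      ∣ a ∣ + ∣ b ∣  <⟨ ℚP.+-mono-< a< b< ⟩
      ½ * ε + ½ * ε  ≡⟨ halves ε ⟩
      ε              ∎

    shrink : ∀ B {ε} → 0ℚ < B → 0ℚ < ε → ∃[ δ ] (0ℚ < δ × B * δ ≡ ½ * ε)
    shrink B {ε} 0<B 0<ε = B⁻¹ * (½ * ε) , pos , B*δ
      where
      instance
        B>0 : ℚ.Positive B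
        B>0 = ℚ.positive 0<B
        B≢0 : ℚ.NonZero B
        B≢0 = ℚP.pos⇒nonZero B
      B⁻¹ : ℚ
      B⁻¹ = ℚ.1/ B
      pos : 0ℚ < B⁻¹ * (½ * ε)
      pos = ℚP.positive⁻¹ _
              {{ℚP.pos*pos⇒pos B⁻¹ {{ℚP.1/pos⇒pos B}} (½ * ε) {{ℚ.positive (half 0<ε)}}}}
      B*δ : B * (B⁻¹ * (½ * ε)) ≡ ½ * ε
      B*δ = trans (sym (ℚP.*-assoc B B⁻¹ (½ * ε)))
              (trans (cong (_* (½ * ε)) (ℚP.*-inverseʳ B)) (ℚP.*-identityˡ (½ * ε)))

    *-small : ∀ {B δ η a b} → 0ℚ < δ → B * δ ≡ η → ∣ a ∣ < B → ∣ b ∣ < δ → ∣ a * b ∣ < η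
    *-small {B} {δ} {η} {a} {b} 0<δ eq a< b< = begin-strict
      ∣ a * b ∣      ≡⟨ ℚP.∣p*q∣≡∣p∣*∣q∣ a b ⟩
      ∣ a ∣ * ∣ b ∣  ≤⟨ ℚP.*-monoˡ-≤-nonNeg ∣ a ∣ {{ℚP.∣-∣-nonNeg a}} (ℚP.<⇒≤ b<) ⟩
      ∣ a ∣ * δ      <⟨ ℚP.*-monoˡ-<-pos δ {{ℚ.positive 0<δ}} a< ⟩
      B * δ          ≡⟨ eq ⟩
      η              ∎

    bound : (x : ℝ) → ∃[ B ] (0ℚ < B × ∃[ N ] (∀ n → N ℕ.≤ n → ∣ seq x n ∣ < B))
    bound x with cauchy x 1ℚ (ℚP.positive⁻¹ 1ℚ)
    ... | N , c = 1ℚ + ∣ seq x N ∣ , 0<B , N , bnd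
      where
      0<B : 0ℚ < 1ℚ + ∣ seq x N ∣
      0<B = ℚP.+-mono-<-≤ {0ℚ} {1ℚ} {0ℚ} (ℚP.positive⁻¹ 1ℚ) (ℚP.0≤∣p∣ (seq x N))
      bnd : ∀ n → N ℕ.≤ n → ∣ seq x n ∣ < 1ℚ + ∣ seq x N ∣
      bnd n N≤n = begin-strict
        ∣ seq x n ∣                          ≡⟨ cong ∣_∣ (split (seq x n) (seq x N)) ⟩
        ∣ (seq x n - seq x N) + seq x N ∣    ≤⟨ ℚP.∣p+q∣≤∣p∣+∣q∣ (seq x n - seq x N) (seq x N) ⟩
        ∣ seq x n - seq x N ∣ + ∣ seq x N ∣  <⟨ ℚP.+-monoˡ-< ∣ seq x N ∣ (c n N N≤n ℕP.≤-refl) ⟩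
        1ℚ + ∣ seq x N ∣                     ∎

    ≤⊔ˡ : ∀ m n {o} → m ℕ.⊔ n ℕ.≤ o → m ℕ.≤ o
    ≤⊔ˡ m n = ℕP.m⊔n≤o⇒m≤o m n

    ≤⊔ʳ : ∀ m n {o} → m ℕ.⊔ n ℕ.≤ o → n ℕ.≤ o
    ≤⊔ʳ m n = ℕP.m⊔n≤o⇒n≤o m n

    const-small : ∀ {ε} → 0ℚ < ε → ∀ a b → a ≡ b → ∣ a - b ∣ < ε
    const-small {ε} 0<ε a b refl = subst (λ z → ∣ z ∣ < ε) (sym (ℚP.+-inverseʳ a)) 0<ε

  const : ℚ → ℝ
  const q = mkℝ (λ _ → q) λ ε 0<ε → 0 , λ m n _ _ → const-small 0<ε q q refl

  infixl 6 _+ᴿ_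
  infixl 7 _*ᴿ_
  infix  8 -ᴿ_

  _+ᴿ_ : ℝ → ℝ → ℝ
  seq (x +ᴿ y) n = seq x n + seq y n
  cauchy (x +ᴿ y) ε 0<ε with cauchy x (½ * ε) (half 0<ε) | cauchy y (½ * ε) (half 0<ε)
  ... | M , p | N , q = M ℕ.⊔ N , λ m n l k →
    subst (λ z → ∣ z ∣ < ε) (sym (sum-diff (seq x m) (seq y m) (seq x n) (seq y n)))
      (+-small (p m n (≤⊔ˡ M N l) (≤⊔ˡ M N k)) (q m n (≤⊔ʳ M N l) (≤⊔ʳ M N k)))

  -ᴿ_ : ℝ → ℝ
  seq (-ᴿ x) n = - seq x n
  cauchy (-ᴿ x) ε 0<ε with cauchy x ε 0<ε
  ... | N , p = N , λ m n l k →
    subst (_< ε) (sym (trans (cong ∣_∣ (neg-diff (seq x m) (seq x n))) (ℚP.∣-p∣≡∣p∣ (seq x m - seq x n))))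
      (p m n l k)

  _*ᴿ_ : ℝ → ℝ → ℝ
  seq (x *ᴿ y) n = seq x n * seq y n
  cauchy (x *ᴿ y) ε 0<ε =
    let B , 0<B , K , bx = bound x
        C , 0<C , L , by = bound y
        δ , 0<δ , Bδ = shrink B 0<B 0<ε
        γ , 0<γ , Cγ = shrink C 0<C 0<ε
        M , p = cauchy y δ 0<δ
        N , q = cauchy x γ 0<γ
    in (K ℕ.⊔ L) ℕ.⊔ (M ℕ.⊔ N) , λ m n l k →
      subst (λ z → ∣ z ∣ < ε) (sym (prod-diff (seq x m) (seq y m) (seq x n) (seq y n)))
        (+-small
          (*-small 0<δ Bδ (bx m (≤⊔ˡ K L (≤⊔ˡ (K ℕ.⊔ L) _ l)))
            (p m n (≤⊔ˡ M N (≤⊔ʳ (K ℕ.⊔ L) _ l)) (≤⊔ˡ M N (≤⊔ʳ (K ℕ.⊔ L) _ k))))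
          (*-small 0<γ Cγ (by n (≤⊔ʳ K L (≤⊔ˡ (K ℕ.⊔ L) _ k)))
            (q m n (≤⊔ʳ M N (≤⊔ʳ (K ℕ.⊔ L) _ l)) (≤⊔ʳ M N (≤⊔ʳ (K ℕ.⊔ L) _ k)))))

  private
    pointwise : ∀ {x y} → (∀ n → seq x n ≡ seq y n) → x ≈ y
    pointwise eq = mk≈ λ ε 0<ε → 0 , λ n _ → const-small 0<ε _ _ (eq n)

    ≈-sym : ∀ {x y} → x ≈ y → y ≈ x
    ≈-sym {x} {y} (mk≈ e) = mk≈ λ ε 0<ε → let N , p = e ε 0<ε in N , λ n l →
      subst (_< ε) (sym (trans (cong ∣_∣ (swap-diff (seq y n) (seq x n)))
                               (ℚP.∣-p∣≡∣p∣ (seq x n - seq y n)))) (p n l)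

    ≈-trans : ∀ {x y z} → x ≈ y → y ≈ z → x ≈ z
    ≈-trans {x} {y} {z} (mk≈ e) (mk≈ f) = mk≈ λ ε 0<ε →
      let M , p = e (½ * ε) (half 0<ε)
          N , q = f (½ * ε) (half 0<ε)
      in M ℕ.⊔ N , λ n l →
        subst (λ w → ∣ w ∣ < ε) (sym (chain-diff (seq x n) (seq y n) (seq z n)))
          (+-small (p n (≤⊔ˡ M N l)) (q n (≤⊔ʳ M N l)))

    +-cong : ∀ {x x′ y y′} → x ≈ x′ → y ≈ y′ → x +ᴿ y ≈ x′ +ᴿ y′
    +-cong {x} {x′} {y} {y′} (mk≈ e) (mk≈ f) = mk≈ λ ε 0<ε →
      let M , p = e (½ * ε) (half 0<ε)
          N , q = f (½ * ε) (half 0<ε)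
      in M ℕ.⊔ N , λ n l →
        subst (λ w → ∣ w ∣ < ε) (sym (sum-diff (seq x n) (seq y n) (seq x′ n) (seq y′ n)))
          (+-small (p n (≤⊔ˡ M N l)) (q n (≤⊔ʳ M N l)))

    -‿cong : ∀ {x y} → x ≈ y → -ᴿ x ≈ -ᴿ y
    -‿cong {x} {y} (mk≈ e) = mk≈ λ ε 0<ε → let N , p = e ε 0<ε in N , λ n l →
      subst (_< ε) (sym (trans (cong ∣_∣ (neg-diff (seq x n) (seq y n)))
                               (ℚP.∣-p∣≡∣p∣ (seq x n - seq y n)))) (p n l)

    *-cong : ∀ {x x′ y y′} → x ≈ x′ → y ≈ y′ → x *ᴿ y ≈ x′ *ᴿ y′
    *-cong {x} {x′} {y} {y′} (mk≈ e) (mk≈ f) = mk≈ λ ε 0<ε →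
      let B , 0<B , K , bx = bound x
          C , 0<C , L , by = bound y′
          δ , 0<δ , Bδ = shrink B 0<B 0<ε
          γ , 0<γ , Cγ = shrink C 0<C 0<ε
          M , p = f δ 0<δ
          N , q = e γ 0<γ
      in (K ℕ.⊔ L) ℕ.⊔ (M ℕ.⊔ N) , λ n l →
        subst (λ z → ∣ z ∣ < ε) (sym (prod-diff (seq x n) (seq y n) (seq x′ n) (seq y′ n)))
          (+-small
            (*-small 0<δ Bδ (bx n (≤⊔ˡ K L (≤⊔ˡ (K ℕ.⊔ L) _ l)))
              (p n (≤⊔ˡ M N (≤⊔ʳ (K ℕ.⊔ L) _ l))))
            (*-small 0<γ Cγ (by n (≤⊔ʳ K L (≤⊔ˡ (K ℕ.⊔ L) _ l)))
              (q n (≤⊔ʳ M N (≤⊔ʳ (K ℕ.⊔ L) _ l)))))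

  ℝ-commutativeRing : CommutativeRing 0ℓ 0ℓ
  ℝ-commutativeRing = record
    { Carrier = ℝ ; _≈_ = _≈_ ; _+_ = _+ᴿ_ ; _*_ = _*ᴿ_ ; -_ = -ᴿ_
    ; 0# = const 0ℚ ; 1# = const 1ℚ
    ; isCommutativeRing = record
      { isRing = record
        { +-isAbelianGroup = record
          { isGroup = record
            { isMonoid = record
              { isSemigroup = record
                { isMagma = record
                  { isEquivalence = record
                    { refl = pointwise λ _ → refl ; sym = ≈-sym ; trans = ≈-trans }
                  ; ∙-cong = +-cong }
                ; assoc = λ x y z → pointwise λ n → ℚP.+-assoc (seq x n) (seq y n) (seq z n) }
              ; identity = (λ x → pointwise λ n → ℚP.+-identityˡ (seq x n))
                         , (λ x → pointwise λ n → ℚP.+-identityʳ (seq x n)) }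
            ; inverse = (λ x → pointwise λ n → ℚP.+-inverseˡ (seq x n))
                      , (λ x → pointwise λ n → ℚP.+-inverseʳ (seq x n))
            ; ⁻¹-cong = -‿cong }
          ; comm = λ x y → pointwise λ n → ℚP.+-comm (seq x n) (seq y n) }
        ; *-cong = *-cong
        ; *-assoc = λ x y z → pointwise λ n → ℚP.*-assoc (seq x n) (seq y n) (seq z n)
        ; *-identity = (λ x → pointwise λ n → ℚP.*-identityˡ (seq x n))
                     , (λ x → pointwise λ n → ℚP.*-identityʳ (seq x n))
        ; distrib = (λ x y z → pointwise λ n → ℚP.*-distribˡ-+ (seq x n) (seq y n) (seq z n))
                  , (λ x y z → pointwise λ n → ℚP.*-distribʳ-+ (seq x n) (seq y n) (seq z n)) }
      ; *-comm = λ x y → pointwise λ n → ℚP.*-comm (seq x n) (seq y n) } }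

ℝ : Set
ℝ = Reals.ℝ

open LinearAlgebra Reals.ℝ-commutativeRing public

------------------------------------------------------------------------
-- Arrangements and the coboundary polynomial

-- A subarrangement is a subset of the index set of the family `hyperplane`,
-- which should therefore have no repetitions.  Dimensions of intersections
-- over ℝ cannot be computed in general, hence the field `dimension`.

record Arrangement (n : ℕ) : Set₁ where
  field
    size       : ℕ
    hyperplane : Fin size → Pred (Vector ℝ n) 0ℓ

  ⋂ : Subset size → Pred (Vector ℝ n) 0ℓ
  ⋂ ℬ x = ∀ l → l ∈ ℬ → hyperplane l x

  field
    dimension : ∀ ℬ → ∃[ d ] HasDimension (⋂ ℬ) d

  rank : Subset size → ℕ
  rank ℬ = n ∸ proj₁ (dimension ℬ)

allSubsets : ∀ m → List (Subset m)
allSubsets zero    = [] ∷ []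
allSubsets (suc m) = List.map (outside ∷_) (allSubsets m) ++ List.map (inside ∷_) (allSubsets m)

module _ (R : RawRing 0ℓ 0ℓ) where
  open RawRing R renaming (_+_ to _⊕_; _*_ to _⊗_; -_ to ⊖_)
  open RawSemiringDefs rawSemiring using (_^_)

  sumOver : ∀ {A : Set} → List A → (A → Carrier) → Carrier
  sumOver xs f = foldr _⊕_ 0# (List.map f xs)

  -- The truncated subtraction is exact: rank is monotone.
  coboundary : ∀ {n} → Arrangement n → (q t : Carrier) → Carrier
  coboundary 𝒜 q t = sumOver (allSubsets size) λ ℬ →
    (q ^ (rank ⊤ ∸ rank ℬ)) ⊗ ((t ⊕ (⊖ 1#)) ^ Subset.∣ ℬ ∣)
    where open Arrangement 𝒜

------------------------------------------------------------------------
-- The polynomial ring ℚ[t]; the list c₀ ∷ c₁ ∷ … is c₀ + c₁ t + …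

open import Data.Rational.Base using (ℚ; 0ℚ; 1ℚ; _+_; _*_)

Polynomial : Set
Polynomial = List ℚ

coefficient : Polynomial → ℕ → ℚ
coefficient []      _       = 0ℚ
coefficient (c ∷ _) zero    = c
coefficient (_ ∷ f) (suc k) = coefficient f k

infixl 6 _+ᴾ_
infixl 7 _*ᴾ_

_+ᴾ_ : Polynomial → Polynomial → Polynomial
[]      +ᴾ g       = g
(c ∷ f) +ᴾ []      = c ∷ f
(c ∷ f) +ᴾ (d ∷ g) = c + d ∷ f +ᴾ g

_*ᴾ_ : Polynomial → Polynomial → Polynomial
[]      *ᴾ g = []
(c ∷ f) *ᴾ g = List.map (c *_) g +ᴾ (0ℚ ∷ f *ᴾ g)

constant : ℚ → Polynomial
constant c = c ∷ []

indeterminate : Polynomial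
indeterminate = 0ℚ ∷ 1ℚ ∷ []

ℚ[t] : RawRing 0ℓ 0ℓ
ℚ[t] = record
  { Carrier = Polynomial
  ; _≈_     = λ f g → ∀ k → coefficient f k ≡ coefficient g k
  ; _+_     = _+ᴾ_
  ; _*_     = _*ᴾ_
  ; -_      = List.map (ℚ.-_)
  ; 0#      = []
  ; 1#      = constant 1ℚ
  }

fromℕ : ℕ → ℚ
fromℕ m = ℤ.+ m ℚ./ 1

------------------------------------------------------------------------
-- Positive roots of type A, ideals and the arrangements 𝒜_I

-- The root eᵢ - eⱼ; indices run over Fin n instead of {1, …, n}.

record Root (n : ℕ) : Set where
  constructor root
  field
    i j : Fin n
    i<j : i Fin.< j

root-≡ : ∀ {n} {α β : Root n} → Root.i α ≡ Root.i β → Root.j α ≡ Root.j β → α ≡ β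
root-≡ {α = root i j p} {root _ _ q} refl refl = cong (root i j) (ℕP.<-irrelevant p q)

_≟ᴿ_ : ∀ {n} (α β : Root n) → Dec (α ≡ β)
root i j p ≟ᴿ root i′ j′ q =
  map′ (λ { (e , f) → root-≡ e f }) (λ { refl → refl , refl })
       ((i FinP.≟ i′) ×-dec (j FinP.≟ j′))

infix 4 _≼_ _≼?_

_≼_ : ∀ {n} → Root n → Root n → Set
root i j _ ≼ root i′ j′ _ = i′ Fin.≤ i × j Fin.≤ j′

_≼?_ : ∀ {n} (α β : Root n) → Dec (α ≼ β)
root i j _ ≼? root i′ j′ _ = (i′ FinP.≤? i) ×-dec (j FinP.≤? j′)

root? : ∀ {n} → Fin n × Fin n → Maybe (Root n)
root? (i , j) with i FinP.<? j
... | yes i<j = just (root i j i<j)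
... | no  _   = nothing

positiveRoots : ∀ n → List (Root n)
positiveRoots n = mapMaybe root? (cartesianProduct (allFin n) (allFin n))

∈-positiveRoots : ∀ {n} (α : Root n) → α ∈ₗ positiveRoots n
∈-positiveRoots {n} α@(root i j i<j) =
  AnyP.mapMaybe⁺ root? _
    (Any.map (λ { refl → hit }) (∈-map⁺ root? (∈-cartesianProduct⁺ (∈-allFin i) (∈-allFin j))))
  where
  hit : MAny.Any (α ≡_) (root? (i , j))
  hit with i FinP.<? j
  ... | yes p = MAny.just (root-≡ refl refl)
  ... | no ¬p = contradiction i<j ¬p

IsIdeal : ∀ {n} → Pred (Root n) 0ℓ → Set
IsIdeal I = ∀ {u v} → I u → u ≼ v → I v

IsSimple : ∀ {n} → Pred (Root n) 0ℓ
IsSimple (root i j _) = toℕ j ≡ suc (toℕ i)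

HasFullComplement : ∀ {n} → Pred (Root n) 0ℓ → Set
HasFullComplement I = ∀ α → IsSimple α → ¬ I α

module _ {n : ℕ} {I : Pred (Root n) 0ℓ} (I? : Decidable I) where

  complement : List (Root n)
  complement = filter (∁? I?) (positiveRoots n)

  private
    edge : Fin (length complement) → Fin n × Fin n
    edge l = Root.i (lookup complement l) , Root.j (lookup complement l)

  edges : Subset (length complement) → List (Fin n × Fin n)
  edges ℬ = List.map edge (filter (_∈? ℬ) (allFin _))

  𝒜 : Arrangement n
  𝒜 = record
    { size       = length complement
    ; hyperplane = H
    ; dimension  = λ ℬ → proj₁ (components (edges ℬ)) ,
        HasDimension-resp (to ℬ) (from ℬ)
          (dimension-Equations (proj₂ (components (edges ℬ))))
    }
    where
    H : Fin (length complement) → Pred (Vector ℝ n) 0ℓ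
    H l = Hyperplane (Root.i (lookup complement l)) (Root.j (lookup complement l))

    to : ∀ ℬ x → Equations (edges ℬ) x → ∀ l → l ∈ ℬ → H l x
    to ℬ x eqs l l∈ℬ = eqs (∈-map⁺ edge (∈-filter⁺ (_∈? ℬ) (∈-allFin l) l∈ℬ))

    from : ∀ ℬ x → (∀ l → l ∈ ℬ → H l x) → Equations (edges ℬ) x
    from ℬ x h e with ∈-map⁻ edge e
    ... | l , l∈ , refl = h l (proj₂ (∈-filter⁻ (_∈? ℬ) {xs = allFin _} l∈))

------------------------------------------------------------------------
-- Signatures and the partition in accordance with I

  IsMaximal : Pred (Root n) 0ℓ
  IsMaximal α = ¬ I α × (∀ β → ¬ I β → α ≼ β → β ≡ α)

  isMaximal? : Decidable IsMaximal
  isMaximal? α = ¬? (I? α) ×-dec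
    map′ (λ all β → All.lookup all (∈-positiveRoots β))
         (λ f → All.universal f (positiveRoots n))
         (All.all? (λ β → ¬? (I? β) →-dec ((α ≼? β) →-dec (β ≟ᴿ α))) (positiveRoots n))

  maximalElements : List (Root n)
  maximalElements = filter isMaximal? (positiveRoots n)

  Signature : Set
  Signature = Subset (length maximalElements)

  signature : Fin n → Signature
  signature u = tabulate λ l →
    let open Root (lookup maximalElements l) in does ((i FinP.≤? u) ×-dec (u FinP.≤? j))

  IsConstantOn : Subset n → Set
  IsConstantOn A = ∀ {u v} → u ∈ A → v ∈ A → signature u ≡ signature v

  IsBlock : Subset n → Set
  IsBlock A = Nonempty A × IsConstantOn A × (∀ B → IsConstantOn B → A ⊆ B → B ⊆ A)

  IsMinimumOf : Subset n → Fin n → Set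
  IsMinimumOf A u = u ∈ A × (∀ {v} → v ∈ A → u Fin.≤ v)

  record AccordantPartition : Set where
    field
      r            : ℕ
      A            : Fin r → Subset n
      isBlock      : ∀ u → IsBlock (A u)
      exhaustive   : ∀ B → IsBlock B → ∃[ u ] (A u ≡ B)
      increasing   : ∀ {u v x y} → u Fin.< v →
                     IsMinimumOf (A u) x → IsMinimumOf (A v) y → x Fin.< y
      s            : Fin r → Signature
      s-signature  : ∀ u {x} → x ∈ A u → signature x ≡ s u

    R : Fin r → Subset r
    R u = tabulate λ v → does ((u FinP.<? v) ×-dec nonempty? (s u ∩ s v))

------------------------------------------------------------------------
-- The right-hand side

open import Data.Nat.Combinatorics using (_C_)

open CommutativeMonoidSum ℕP.+-0-commutativeMonoid public using () renaming (sum to ∑)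
open CommutativeMonoidSum ℕP.*-1-commutativeMonoid public using () renaming (sum to ∏)

∑∈ : ∀ {r} → Subset r → (Fin r → ℕ) → ℕ
∑∈ S f = ∑ λ v → if Vec.lookup S v then f v else 0

-- m ! / (a₁ ! ⋯ aₚ !), meant for a₁ + ⋯ + aₚ = m.

multinomial : ∀ {p} → ℕ → Vec ℕ p → ℕ
multinomial m a = ((m !) ℕ./ product (List.map _! as)) {{product≢0 (AllP.map⁺ (All.universal ℕP._!≢0 as))}}
  where as = Vec.toList a

-- All (a₁, …, aₚ) ∈ ℕᵖ with a₁ + ⋯ + aₚ = m.

compositions : ∀ p → ℕ → List (Vec ℕ p)
compositions zero    zero    = [] ∷ []
compositions zero    (suc _) = []
compositions (suc p) m       =
  concatMap (λ a → List.map (a ∷_) (compositions p (m ∸ a))) (upTo (suc m))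

-- All families whose row u is a composition of m u into p parts.

families : ∀ p {r} → (Fin r → ℕ) → List (Vec (Vec ℕ p) r)
families p {zero}  m = [] ∷ []
families p {suc r} m = cartesianProductWith _∷_ (compositions p (m zero)) (families p (m ∘ suc))

module _ {n} {I : Pred (Root n) 0ℓ} {I? : Decidable I} (P : AccordantPartition I?) {p : ℕ} where
  open AccordantPartition P

  multiplicity : Vec (Vec ℕ p) r → ℕ
  multiplicity a = ∏ λ u → multinomial Subset.∣ A u ∣ (Vec.lookup a u)

  exponent : Vec (Vec ℕ p) r → ℕ
  exponent a = ∑ λ u → ∑ λ s → (a[ u , s ] C 2) ℕ.+ a[ u , s ] ℕ.* ∑∈ (R u) (λ v → a[ v , s ])
    where
    a[_,_] : Fin r → Fin p → ℕ
    a[ u , s ] = Vec.lookup (Vec.lookup a u) s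

module Submission where

-- Let d(ℬ) be the number of connected components of the graph with edge set ℬ.
-- Since the complement of I is full, the whole graph is connected, so
-- p · χ̄(p, t) = ∑_ℬ p^d(ℬ) (t - 1)^#ℬ.  Here p^d(ℬ) is the number of colourings
-- x : [n] → [p] that are constant on the edges of ℬ; interchanging the two sums,
-- p · χ̄(p, t) = ∑_x t^#E(x), where E(x) is the set of monochromatic edges of x.
-- Two indices are joined by an edge exactly when their signatures meet, so #E(x)
-- depends only on the numbers a⁽ᵘ⁾ₛ of elements of colour s in the block A⁽ᵘ⁾, and
-- multinomial coefficients count the colourings with given numbers.

open import Defs
open import Algebra.Bundles using (CommutativeMonoid; CommutativeRing)
open import Algebra.Bundles.Raw using (RawRing)
import Algebra.Definitions.RawSemiring as RawSemiringDefs
import Algebra.Properties.CommutativeMonoid.Sum as CommutativeMonoidSum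
import Algebra.Properties.Semiring.Sum as SemiringSum
open import Data.Bool.Base using (Bool; true; false; if_then_else_; _∧_)
import Data.Bool.Properties as Bool
open import Data.Fin.Base as Fin using (Fin; zero; suc; toℕ; inject₁)
open import Data.Fin.Induction using (<-weakInduction)
import Data.Fin.Properties as FinP
open import Data.Fin.Subset using (Subset; inside; outside; ∣_∣; _∈_; _⊆_; _∩_; ⊤; Nonempty)
open import Data.Fin.Subset.Properties using (_⊆?_; _∈?_; nonempty?; ⊆-antisym; x∈p∩q⁺; x∈p∩q⁻; ∩-comm; ∈⊤)
import Data.Integer.Base as ℤ
import Data.Integer.Properties as ℤP
open import Data.List.Base as List using (List; []; _∷_; _++_; foldr; length; filter; mapMaybe; concatMap; cartesianProduct; cartesianProductWith; allFin; upTo)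
open import Data.List.Membership.Propositional using (find; lose) renaming (_∈_ to _∈ₗ_)
open import Data.List.Membership.Propositional.Properties using (∈-map⁺; ∈-map⁻; ∈-filter⁺; ∈-filter⁻; ∈-allFin; ∈-lookup; ∈-upTo⁻; ∈-concatMap⁻)
import Data.List.Properties as ListP
import Data.List.Relation.Unary.All as All
import Data.List.Relation.Unary.All.Properties as AllP
open import Data.List.Relation.Unary.Any as Any using (here; there)
import Data.List.Relation.Unary.Any.Properties as AnyP
open import Data.Maybe.Base using (Maybe; just; nothing; maybe)
open import Data.Nat.Base as ℕ using (ℕ; zero; suc; _∸_; _!; _≤_; s≤s; z≤n)
open import Data.Nat.Combinatorics using (_C_; nCk+nC[k+1]≡[n+1]C[k+1]; k>n⇒nCk≡0; nC1≡n; nCk≡n!/k![n-k]!; k![n∸k]!∣n!)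
open import Data.Nat.DivMod using (m*n/n≡m; m/n*n≡m)
open import Data.Nat.Divisibility using (_∣_; 1∣_; ∣-trans; *-monoʳ-∣)
open import Data.Nat.Induction using (<-wellFounded)
open import Data.Nat.ListAction using (product)
open import Data.Nat.ListAction.Properties using (product≢0)
open import Data.Nat.Primality using (Prime; prime⇒nonZero)
import Data.Nat.Properties as ℕP
import Data.Nat.Solver as ℕSolver
open import Data.Product.Base using (_×_; _,_; proj₁; proj₂; ∃-syntax)
open import Data.Rational.Base as ℚ using (ℚ; 0ℚ; 1ℚ; _/_)
import Data.Rational.Properties as ℚP
import Data.Rational.Solver as ℚSolver
import Data.Rational.Unnormalised.Base as ℚᵘ
import Data.Rational.Unnormalised.Properties as ℚᵘP
open import Data.Vec.Base as Vec using (Vec; []; _∷_; here; there; lookup; tabulate)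
import Data.Vec.Properties as VecP
open import Function.Base using (_∘_)
open import Function.Bundles using (_⇔_; mk⇔; Equivalence)
open import Induction.WellFounded using (Acc; acc)
open import Level using (0ℓ)
import Relation.Binary.Construct.Closure.Equivalence as EqC
open import Relation.Binary.Definitions using (tri<; tri≈; tri>)
open import Relation.Binary.PropositionalEquality using (_≡_; _≢_; _≗_; refl; sym; trans; cong; cong₂; subst; isEquivalence; module ≡-Reasoning)
open import Relation.Nullary.Decidable using (Dec; yes; no; does; does-⇔; _×-dec_; ¬?; dec-true; dec-false)
open import Relation.Nullary.Negation using (¬_; contradiction)
open import Relation.Unary using (Pred; Decidable)
open import Relation.Unary.Properties using (∁?)

-- Two steps of the overview hide a difficulty. Counting the colourings with given block counts
-- would call for a bijection with words. Instead, the sum over all colourings and the multinomially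
-- weighted sum over families are shown to obey the same recursion, in which one more index in block
-- `u` with colour `s` raises one entry by one. In the exponent, edges are pairs i < j of indices
-- while blocks are paired by u < v, and a direct match would have to compare the two orders. All
-- ordered pairs are therefore counted, once by index and once by block: each count is n plus twice
-- the number wanted, so n and the factor 2 cancel. The n diagonal pairs belong to the count because
-- every signature is nonempty, which makes each block adjacent to itself. Polynomials are lists
-- compared coefficientwise, so the sums are compared at a fixed degree `k` as sums of rationals;
-- multiplication by t becomes a shift of degree.

private
  module ℕΣ = CommutativeMonoidSum ℕP.+-0-commutativeMonoid

-- Sums over lists in a commutative monoid

module ListSum (M : CommutativeMonoid 0ℓ 0ℓ) where
  open CommutativeMonoid M renaming
    ( _∙_ to _+_; ε to 0#; ∙-cong to +-cong; ∙-congˡ to +-congˡ; identityˡ to +-identityˡ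
    ; identityʳ to +-identityʳ; assoc to +-assoc; refl to ≈-refl; sym to ≈-sym; trans to ≈-trans )
  open CommutativeMonoidSum M
  open import Relation.Binary.Reasoning.Setoid setoid

  private
    variable
      A B C : Set

  Σ[_] : List A → (A → Carrier) → Carrier
  Σ[ xs ] f = foldr _+_ 0# (List.map f xs)

  ∑-single : ∀ {n} (i : Fin n) (f : Fin n → Carrier) →
             sum (λ j → if does (i FinP.≟ j) then f j else 0#) ≈ f i
  ∑-single {suc n} zero f = ≈-trans (+-congˡ (sum-replicate-zero n)) (+-identityʳ _)
  ∑-single (suc i) f = ≈-trans (+-identityˡ _) (∑-single i (f ∘ suc))

  Σ-lookup : ∀ (xs : List A) f → Σ[ xs ] f ≈ sum (f ∘ List.lookup xs)
  Σ-lookup []       f = ≈-refl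
  Σ-lookup (x ∷ xs) f = +-congˡ (Σ-lookup xs f)

  Σ-cong : ∀ (xs : List A) {f g} → (∀ {x} → x ∈ₗ xs → f x ≈ g x) → Σ[ xs ] f ≈ Σ[ xs ] g
  Σ-cong []       eq = ≈-refl
  Σ-cong (x ∷ xs) eq = +-cong (eq (here refl)) (Σ-cong xs (eq ∘ there))

  Σ-zero : ∀ (xs : List A) → Σ[ xs ] (λ _ → 0#) ≈ 0#
  Σ-zero []       = ≈-refl
  Σ-zero (x ∷ xs) = ≈-trans (+-identityˡ _) (Σ-zero xs)

  Σ-++ : ∀ (xs ys : List A) f → Σ[ xs ++ ys ] f ≈ Σ[ xs ] f + Σ[ ys ] f
  Σ-++ []       ys f = ≈-sym (+-identityˡ _)
  Σ-++ (x ∷ xs) ys f = ≈-trans (+-congˡ (Σ-++ xs ys f)) (≈-sym (+-assoc _ _ _))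

  Σ-map : ∀ (xs : List A) (g : A → B) f → Σ[ List.map g xs ] f ≈ Σ[ xs ] (f ∘ g)
  Σ-map []       g f = ≈-refl
  Σ-map (x ∷ xs) g f = +-congˡ (Σ-map xs g f)

  Σ-concatMap : ∀ (xs : List A) (g : A → List B) f →
                Σ[ concatMap g xs ] f ≈ Σ[ xs ] (λ x → Σ[ g x ] f)
  Σ-concatMap []       g f = ≈-refl
  Σ-concatMap (x ∷ xs) g f = ≈-trans (Σ-++ (g x) _ f) (+-congˡ (Σ-concatMap xs g f))

  Σ-cartesianProductWith : ∀ (g : A → B → C) xs ys f →
    Σ[ cartesianProductWith g xs ys ] f ≈ Σ[ xs ] (λ x → Σ[ ys ] (λ y → f (g x y)))
  Σ-cartesianProductWith g []       ys f = ≈-refl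
  Σ-cartesianProductWith g (x ∷ xs) ys f =
    ≈-trans (Σ-++ (List.map (g x) ys) _ f)
          (+-cong (Σ-map ys (g x) f) (Σ-cartesianProductWith g xs ys f))

  Σ-filter : ∀ {P : Pred A 0ℓ} (P? : Decidable P) xs f →
             Σ[ filter P? xs ] f ≈ Σ[ xs ] (λ x → if does (P? x) then f x else 0#)
  Σ-filter P? []       f = ≈-refl
  Σ-filter P? (x ∷ xs) f with does (P? x)
  ... | true  = +-congˡ (Σ-filter P? xs f)
  ... | false = ≈-trans (Σ-filter P? xs f) (≈-sym (+-identityˡ _))

  Σ-mapMaybe : ∀ (g : A → Maybe B) xs f → Σ[ mapMaybe g xs ] f ≈ Σ[ xs ] (maybe f 0# ∘ g)
  Σ-mapMaybe g []       f = ≈-refl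
  Σ-mapMaybe g (x ∷ xs) f with g x
  ... | just _  = +-congˡ (Σ-mapMaybe g xs f)
  ... | nothing = ≈-trans (Σ-mapMaybe g xs f) (≈-sym (+-identityˡ _))

  Σ-allFin : ∀ n f → Σ[ allFin n ] f ≈ sum f
  Σ-allFin n f = go (λ i → i)
    where
    go : ∀ {m} (g : Fin m → Fin n) → Σ[ List.tabulate g ] f ≈ sum (f ∘ g)
    go {zero}  g = ≈-refl
    go {suc m} g = +-congˡ (go (g ∘ suc))

  Σ-distrib-+ : ∀ (xs : List A) f g → Σ[ xs ] (λ x → f x + g x) ≈ Σ[ xs ] f + Σ[ xs ] g
  Σ-distrib-+ xs f g = begin
    Σ[ xs ] (λ x → f x + g x)                      ≈⟨ Σ-lookup xs _ ⟩
    sum (λ i → f (List.lookup xs i) + g (List.lookup xs i))  ≈⟨ ∑-distrib-+ (f ∘ List.lookup xs) (g ∘ List.lookup xs) ⟩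
    sum (f ∘ List.lookup xs) + sum (g ∘ List.lookup xs)      ≈⟨ +-cong (Σ-lookup xs f) (Σ-lookup xs g) ⟨
    Σ[ xs ] f + Σ[ xs ] g                          ∎

  Σ-∑-comm : ∀ {n} (xs : List A) (f : A → Fin n → Carrier) →
             Σ[ xs ] (sum ∘ f) ≈ sum (λ i → Σ[ xs ] (λ x → f x i))
  Σ-∑-comm xs f = begin
    Σ[ xs ] (sum ∘ f)                        ≈⟨ Σ-lookup xs _ ⟩
    sum (sum ∘ f ∘ List.lookup xs)                ≈⟨ ∑-comm (f ∘ List.lookup xs) ⟩
    sum (λ i → sum (λ k → f (List.lookup xs k) i)) ≈⟨ sum-cong-≋ (λ i → Σ-lookup xs (λ x → f x i)) ⟨
    sum (λ i → Σ[ xs ] (λ x → f x i))        ∎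

  Σ-comm : ∀ (xs : List A) (ys : List B) (f : A → B → Carrier) →
           Σ[ xs ] (λ x → Σ[ ys ] (f x)) ≈ Σ[ ys ] (λ y → Σ[ xs ] (λ x → f x y))
  Σ-comm xs ys f = begin
    Σ[ xs ] (λ x → Σ[ ys ] (f x))                 ≈⟨ Σ-cong xs (λ {x} _ → Σ-lookup ys (f x)) ⟩
    Σ[ xs ] (λ x → sum (f x ∘ List.lookup ys))         ≈⟨ Σ-∑-comm xs (λ x → f x ∘ List.lookup ys) ⟩
    sum (λ i → Σ[ xs ] (λ x → f x (List.lookup ys i))) ≈⟨ Σ-lookup ys _ ⟨
    Σ[ ys ] (λ y → Σ[ xs ] (λ x → f x y))         ∎

open ≡-Reasoning

𝟙 : Bool → ℕ
𝟙 b = if b then 1 else 0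

-- Sums over families of compositions weighted by multinomial coefficients

module _ where
  open import Data.Rational.Base using (_+_; _*_)
  open ListSum ℚP.+-0-commutativeMonoid
  open SemiringSum (CommutativeRing.semiring ℚP.+-*-commutativeRing)

  fromℚᵘ-homo-+ : ∀ x y → ℚ.fromℚᵘ (x ℚᵘ.+ y) ≡ ℚ.fromℚᵘ x + ℚ.fromℚᵘ y
  fromℚᵘ-homo-+ x y = ℚP.toℚᵘ-injective (ℚᵘP.≃-trans (ℚP.toℚᵘ-fromℚᵘ (x ℚᵘ.+ y))
    (ℚᵘP.≃-trans (ℚᵘP.+-cong (ℚᵘP.≃-sym (ℚP.toℚᵘ-fromℚᵘ x)) (ℚᵘP.≃-sym (ℚP.toℚᵘ-fromℚᵘ y)))
                 (ℚᵘP.≃-sym (ℚP.toℚᵘ-homo-+ (ℚ.fromℚᵘ x) (ℚ.fromℚᵘ y)))))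

  fromℚᵘ-homo-* : ∀ x y → ℚ.fromℚᵘ (x ℚᵘ.* y) ≡ ℚ.fromℚᵘ x * ℚ.fromℚᵘ y
  fromℚᵘ-homo-* x y = ℚP.toℚᵘ-injective (ℚᵘP.≃-trans (ℚP.toℚᵘ-fromℚᵘ (x ℚᵘ.* y))
    (ℚᵘP.≃-trans (ℚᵘP.*-cong (ℚᵘP.≃-sym (ℚP.toℚᵘ-fromℚᵘ x)) (ℚᵘP.≃-sym (ℚP.toℚᵘ-fromℚᵘ y)))
                 (ℚᵘP.≃-sym (ℚP.toℚᵘ-homo-* (ℚ.fromℚᵘ x) (ℚ.fromℚᵘ y)))))

  private
    -- `fromℕ m` is by definition `ℚ.fromℚᵘ (natural m)`. The arithmetic of `fromℕ` is thus checked
    -- on unnormalised fractions, where equality is cross-multiplication, and carried over by the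
    -- homomorphism laws above.
    natural : ℕ → ℚᵘ.ℚᵘ
    natural m = ℚᵘ.mkℚᵘ (ℤ.+ m) 0

  fromℕ-+ : ∀ m n → fromℕ (m ℕ.+ n) ≡ fromℕ m + fromℕ n
  fromℕ-+ m n = trans
    (ℚP.fromℚᵘ-cong {natural (m ℕ.+ n)} {natural m ℚᵘ.+ natural n}
      (ℚᵘ.*≡* (cong (ℤ._* ℤ.1ℤ) (sym (cong₂ ℤ._+_ (ℤP.*-identityʳ (ℤ.+ m)) (ℤP.*-identityʳ (ℤ.+ n)))))))
    (fromℚᵘ-homo-+ (natural m) (natural n))

  fromℕ-* : ∀ m n → fromℕ (m ℕ.* n) ≡ fromℕ m * fromℕ n
  fromℕ-* m n = trans
    (ℚP.fromℚᵘ-cong {natural (m ℕ.* n)} {natural m ℚᵘ.* natural n} (ℚᵘ.*≡* (cong (ℤ._* ℤ.1ℤ) (ℤP.pos-* m n))))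
    (fromℚᵘ-homo-* (natural m) (natural n))

  1/n*n≡1 : ∀ n .{{_ : ℕ.NonZero n}} → (ℤ.1ℤ ℚ./ n) * fromℕ n ≡ 1ℚ
  1/n*n≡1 n@(suc k) = trans (sym (fromℚᵘ-homo-* (ℚᵘ.mkℚᵘ ℤ.1ℤ k) (natural n)))
    (ℚP.fromℚᵘ-cong {ℚᵘ.mkℚᵘ ℤ.1ℤ k ℚᵘ.* natural n} {natural 1}
      (ℚᵘ.*≡* (cong (λ l → ℤ.+ (suc l)) (trans (ℕP.*-identityʳ (k ℕ.+ 0)) (cong (ℕ._+ 0) (sym (ℕP.*-identityʳ k)))))))

  Σ-*ˡ : ∀ {A : Set} (xs : List A) c f → c * Σ[ xs ] f ≡ Σ[ xs ] (λ x → c * f x)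
  Σ-*ˡ []       c f = ℚP.*-zeroʳ c
  Σ-*ˡ (x ∷ xs) c f = trans (ℚP.*-distribˡ-+ c _ _) (cong (c * f x +_) (Σ-*ˡ xs c f))

  -- Multinomial coefficients and the recursion of the weighted sums

  factorials : ∀ {p} → Vec ℕ p → ℕ
  factorials a = product (List.map _! (Vec.toList a))

  factorials≢0 : ∀ {p} (a : Vec ℕ p) → ℕ.NonZero (factorials a)
  factorials≢0 a = product≢0 (AllP.map⁺ (All.universal ℕP._!≢0 (Vec.toList a)))

  -- This makes the truncating division in `multinomial` exact. Inductively the tail divides m!, and
  -- k! m! divides (k + m)! by integrality of binomial coefficients.
  factorials∣sum! : ∀ {p} (a : Vec ℕ p) → factorials a ∣ Vec.sum a !
  factorials∣sum! []      = 1∣ 1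
  factorials∣sum! (k ∷ a) = ∣-trans (*-monoʳ-∣ (k !) (factorials∣sum! a))
    (subst (λ m → k ! ℕ.* m ! ∣ (k ℕ.+ Vec.sum a) !) (ℕP.m+n∸m≡n k (Vec.sum a))
      (k![n∸k]!∣n! (ℕP.m≤m+n k (Vec.sum a))))

  -- Choose the places of the first letter, then arrange the others. Quotients are avoided:
  -- multiplying the right-hand side by the divisor of the left gives (k + m)!, and division then
  -- cancels exactly.
  multinomial-∷ : ∀ {p} k (a : Vec ℕ p) →
    multinomial (k ℕ.+ Vec.sum a) (k ∷ a) ≡ ((k ℕ.+ Vec.sum a) C k) ℕ.* multinomial (Vec.sum a) a
  multinomial-∷ k a =
    trans (cong (λ N → (N ℕ./ factorials (k ∷ a)) {{factorials≢0 (k ∷ a)}}) (sym total))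
          (m*n/n≡m (c ℕ.* d) (factorials (k ∷ a)) {{factorials≢0 (k ∷ a)}})
    where
    m = Vec.sum a
    c = (k ℕ.+ m) C k
    d = multinomial m a
    k≤k+m = ℕP.m≤m+n k m
    instance
      _ = factorials≢0 a
      _ = k ℕP.!* ((k ℕ.+ m) ∸ k) !≢0
    open ℕSolver.+-*-Solver
    total : c ℕ.* d ℕ.* (k ! ℕ.* factorials a) ≡ (k ℕ.+ m) !
    total = begin
      c ℕ.* d ℕ.* (k ! ℕ.* factorials a)    ≡⟨ solve 4 (λ x y z w → x :* y :* (z :* w) := x :* (z :* (y :* w)))
            refl c d (k !) (factorials a) ⟩
      c ℕ.* (k ! ℕ.* (d ℕ.* factorials a))  ≡⟨ cong (λ z → c ℕ.* (k ! ℕ.* z)) (m/n*n≡m (factorials∣sum! a)) ⟩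
      c ℕ.* (k ! ℕ.* m !)                   ≡⟨ cong (λ z → c ℕ.* (k ! ℕ.* z !)) (ℕP.m+n∸m≡n k m) ⟨
      c ℕ.* (k ! ℕ.* (k ℕ.+ m ∸ k) !)       ≡⟨ cong (ℕ._* (k ! ℕ.* (k ℕ.+ m ∸ k) !)) (nCk≡n!/k![n-k]! k≤k+m) ⟩
      (k ℕ.+ m) ! ℕ./ (k ! ℕ.* (k ℕ.+ m ∸ k) !) ℕ.* (k ! ℕ.* (k ℕ.+ m ∸ k) !)
                                            ≡⟨ m/n*n≡m (k![n∸k]!∣n! k≤k+m) ⟩
      (k ℕ.+ m) !                           ∎

  sum-compositions : ∀ p m {a : Vec ℕ p} → a ∈ₗ compositions p m → Vec.sum a ≡ m
  sum-compositions zero    zero    (here refl) = refl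
  sum-compositions (suc p) m       a∈
    with find (∈-concatMap⁻ (λ k → List.map (k ∷_) (compositions p (m ∸ k))) {xs = upTo (suc m)} a∈)
  ... | k , k∈ , a∈′ with ∈-map⁻ (k ∷_) a∈′
  ...   | b , b∈ , refl = trans (cong (k ℕ.+_) (sum-compositions p (m ∸ k) b∈))
                                (ℕP.m+[n∸m]≡n (ℕ.s≤s⁻¹ (∈-upTo⁻ k∈)))

  -- In effect the sum of `f` over the words of length `m` in `p` letters, evaluated at their letter
  -- counts: `multinomial m a` is the number of words with counts `a`.
  weightedSum : ∀ p (m : ℕ) → (Vec ℕ p → ℚ) → ℚ
  weightedSum p m f = Σ[ compositions p m ] (λ a → fromℕ (multinomial m a) * f a)

  weightedSum-∷ : ∀ p m f → weightedSum (suc p) m f ≡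
    Σ[ upTo (suc m) ] (λ k → fromℕ (m C k) * weightedSum p (m ∸ k) (λ a → f (k ∷ a)))
  weightedSum-∷ p m f = trans
    (Σ-concatMap (upTo (suc m)) (λ k → List.map (k ∷_) (compositions p (m ∸ k))) _)
    (Σ-cong (upTo (suc m)) λ {k} k∈ → begin
      Σ[ List.map (k ∷_) (compositions p (m ∸ k)) ] _
        ≡⟨ Σ-map (compositions p (m ∸ k)) (k ∷_) _ ⟩
      Σ[ compositions p (m ∸ k) ] (λ a → fromℕ (multinomial m (k ∷ a)) * f (k ∷ a))
        ≡⟨ Σ-cong (compositions p (m ∸ k)) (λ {a} a∈ → factor (ℕ.s≤s⁻¹ (∈-upTo⁻ k∈)) a (sum-compositions p _ a∈)) ⟩
      Σ[ compositions p (m ∸ k) ] (λ a → fromℕ (m C k) * (fromℕ (multinomial (m ∸ k) a) * f (k ∷ a)))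
        ≡⟨ Σ-*ˡ (compositions p (m ∸ k)) (fromℕ (m C k)) _ ⟨
      fromℕ (m C k) * weightedSum p (m ∸ k) (λ a → f (k ∷ a)) ∎)
    where
    factor : ∀ {k} → k ≤ m → ∀ a → Vec.sum a ≡ m ∸ k →
             fromℕ (multinomial m (k ∷ a)) * f (k ∷ a) ≡
             fromℕ (m C k) * (fromℕ (multinomial (m ∸ k) a) * f (k ∷ a))
    factor {k} k≤m a eq = trans (cong (λ z → fromℕ z * f (k ∷ a)) split)
      (trans (cong (_* f (k ∷ a)) (fromℕ-* (m C k) (multinomial (m ∸ k) a)))
            (ℚP.*-assoc (fromℕ (m C k)) (fromℕ (multinomial (m ∸ k) a)) (f (k ∷ a))))
      where
      split : multinomial m (k ∷ a) ≡ (m C k) ℕ.* multinomial (m ∸ k) a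
      split = subst (λ l → multinomial l (k ∷ a) ≡ (l C k) ℕ.* multinomial (m ∸ k) a)
                    (trans (cong (k ℕ.+_) eq) (ℕP.m+[n∸m]≡n k≤m))
                    (trans (multinomial-∷ k a) (cong (λ s → ((k ℕ.+ Vec.sum a) C k) ℕ.* multinomial s a) eq))

  Σ-upTo-suc : ∀ n f → Σ[ upTo (suc n) ] f ≡ f 0 + Σ[ upTo n ] (f ∘ suc)
  Σ-upTo-suc n f = cong (f 0 +_) (trans (cong (λ ks → Σ[ ks ] f) (sym (ListP.map-upTo suc n))) (Σ-map (upTo n) suc f))

  Σ-upTo-last : ∀ n f → Σ[ upTo (suc n) ] f ≡ Σ[ upTo n ] f + f n
  Σ-upTo-last n f = trans (cong (λ ks → Σ[ ks ] f) (sym (ListP.upTo-∷ʳ n)))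
    (trans (Σ-++ (upTo n) (n ∷ []) f) (cong (Σ[ upTo n ] f +_) (ℚP.+-identityʳ (f n))))

  increment : ∀ {p} → Fin p → Vec ℕ p → Vec ℕ p
  increment s a = Vec.updateAt a s suc

  weightedSum-zero : ∀ p f → weightedSum p 0 f ≡ f (Vec.replicate p 0)
  weightedSum-zero zero    f = trans (ℚP.+-identityʳ _) (ℚP.*-identityˡ (f []))
  weightedSum-zero (suc p) f = begin
    weightedSum (suc p) 0 f                     ≡⟨ weightedSum-∷ p 0 f ⟩
    1ℚ * weightedSum p 0 (λ a → f (0 ∷ a)) + 0ℚ ≡⟨ ℚP.+-identityʳ _ ⟩
    1ℚ * weightedSum p 0 (λ a → f (0 ∷ a))      ≡⟨ ℚP.*-identityˡ _ ⟩
    weightedSum p 0 (λ a → f (0 ∷ a))           ≡⟨ weightedSum-zero p (λ a → f (0 ∷ a)) ⟩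
    f (0 ∷ Vec.replicate p 0)                   ∎

  -- A word of length m + 1 is a letter `s` followed by a word of length m. On the formulas this is
  -- Pascal's rule for the size of the first part: one summand, `X`, gives the extra letter to the
  -- first part, the other leaves it to the remaining parts, where induction on `p` applies.
  weightedSum-suc : ∀ p m f → weightedSum p (suc m) f ≡ sum (λ s → weightedSum p m (f ∘ increment s))
  weightedSum-suc zero    m f = refl
  weightedSum-suc (suc p) m f = begin
    weightedSum (suc p) (suc m) f
      ≡⟨ weightedSum-∷ p (suc m) f ⟩
    Σ[ upTo (2 ℕ.+ m) ] (λ k → fromℕ (suc m C k) * W k (suc m ∸ k))
      ≡⟨ Σ-upTo-suc (suc m) (λ k → fromℕ (suc m C k) * W k (suc m ∸ k)) ⟩
    fromℕ 1 * W 0 (suc m) + Σ[ upTo (suc m) ] (λ k → fromℕ (suc m C suc k) * W (suc k) (m ∸ k))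
      ≡⟨ cong (fromℕ 1 * W 0 (suc m) +_) (trans (Σ-cong (upTo (suc m)) (λ {k} _ → pascal k))
            (Σ-distrib-+ (upTo (suc m)) (λ k → fromℕ (m C k) * W (suc k) (m ∸ k))
                  (λ k → fromℕ (m C suc k) * W (suc k) (m ∸ k)))) ⟩
    fromℕ 1 * W 0 (suc m) + (X + Y)
      ≡⟨ solve 3 (λ x y z → x :+ (y :+ z) := y :+ (x :+ z)) refl (fromℕ 1 * W 0 (suc m)) X Y ⟩
    X + (fromℕ 1 * W 0 (suc m) + Y)
      ≡⟨ cong₂ _+_ (sym (weightedSum-∷ p m (f ∘ increment zero))) tail ⟩
    weightedSum (suc p) m (f ∘ increment zero) + sum (λ s → weightedSum (suc p) m (f ∘ increment (suc s))) ∎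
    where
    open ℚSolver.+-*-Solver
    W : ℕ → ℕ → ℚ
    W k l = weightedSum p l (λ a → f (k ∷ a))
    X = Σ[ upTo (suc m) ] (λ k → fromℕ (m C k) * W (suc k) (m ∸ k))
    Y = Σ[ upTo (suc m) ] (λ k → fromℕ (m C suc k) * W (suc k) (m ∸ k))
    pascal : ∀ k → fromℕ (suc m C suc k) * W (suc k) (m ∸ k) ≡
                   fromℕ (m C k) * W (suc k) (m ∸ k) + fromℕ (m C suc k) * W (suc k) (m ∸ k)
    pascal k = trans (cong (λ c → fromℕ c * W (suc k) (m ∸ k)) (sym (nCk+nC[k+1]≡[n+1]C[k+1] m k)))
      (trans (cong (_* W (suc k) (m ∸ k)) (fromℕ-+ (m C k) (m C suc k)))
             (ℚP.*-distribʳ-+ (W (suc k) (m ∸ k)) (fromℕ (m C k)) (fromℕ (m C suc k))))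
    -- `Y` together with the term of index 0 is one sum over k up to m + 1 with coefficients
    -- `m C k`. Its last term vanishes because `m C suc m` is 0, and for k at most m the remaining
    -- total is a genuine successor, as the induction hypothesis requires.
    tail : fromℕ 1 * W 0 (suc m) + Y ≡ sum (λ s → weightedSum (suc p) m (f ∘ increment (suc s)))
    tail = begin
      fromℕ 1 * W 0 (suc m) + Y
        ≡⟨ Σ-upTo-suc (suc m) (λ k → fromℕ (m C k) * W k (suc m ∸ k)) ⟨
      Σ[ upTo (2 ℕ.+ m) ] (λ k → fromℕ (m C k) * W k (suc m ∸ k))
        ≡⟨ Σ-upTo-last (suc m) (λ k → fromℕ (m C k) * W k (suc m ∸ k)) ⟩
      Σ[ upTo (suc m) ] (λ k → fromℕ (m C k) * W k (suc m ∸ k)) + fromℕ (m C suc m) * W (suc m) (m ∸ m)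
        ≡⟨ cong (λ c → Σ[ upTo (suc m) ] (λ k → fromℕ (m C k) * W k (suc m ∸ k)) + fromℕ c * W (suc m) (m ∸ m))
              (k>n⇒nCk≡0 (ℕP.n<1+n m)) ⟩
      Σ[ upTo (suc m) ] (λ k → fromℕ (m C k) * W k (suc m ∸ k)) + 0ℚ * W (suc m) (m ∸ m)
        ≡⟨ trans (cong (Σ[ upTo (suc m) ] (λ k → fromℕ (m C k) * W k (suc m ∸ k)) +_) (ℚP.*-zeroˡ (W (suc m) (m ∸ m))))
              (ℚP.+-identityʳ _) ⟩
      Σ[ upTo (suc m) ] (λ k → fromℕ (m C k) * W k (suc m ∸ k))
        ≡⟨ Σ-cong (upTo (suc m)) (λ {k} k∈ → trans
             (cong (λ l → fromℕ (m C k) * W k l) (ℕP.+-∸-assoc 1 (ℕ.s≤s⁻¹ (∈-upTo⁻ k∈))))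
             (trans (cong (fromℕ (m C k) *_) (weightedSum-suc p (m ∸ k) (λ a → f (k ∷ a))))
                    (*-distribˡ-sum (fromℕ (m C k)) (λ s → weightedSum p (m ∸ k) (λ a → f (k ∷ increment s a)))))) ⟩
      Σ[ upTo (suc m) ] (λ k → sum (λ s → fromℕ (m C k) * weightedSum p (m ∸ k) (λ a → f (k ∷ increment s a))))
        ≡⟨ Σ-∑-comm (upTo (suc m)) (λ k s → fromℕ (m C k) * weightedSum p (m ∸ k) (λ a → f (k ∷ increment s a))) ⟩
      sum (λ s → Σ[ upTo (suc m) ] (λ k → fromℕ (m C k) * weightedSum p (m ∸ k) (λ a → f (k ∷ increment s a))))
        ≡⟨ sum-cong-≗ (λ s → weightedSum-∷ p m (f ∘ increment (suc s))) ⟨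
      sum (λ s → weightedSum (suc p) m (f ∘ increment (suc s))) ∎

  weightedFamilySum : ∀ p {r} → (Fin r → ℕ) → (Vec (Vec ℕ p) r → ℚ) → ℚ
  weightedFamilySum p m f =
    Σ[ families p m ] (λ a → fromℕ (∏ λ u → multinomial (m u) (lookup a u)) * f a)

  weightedSum-cong : ∀ p m {f g} → f ≗ g → weightedSum p m f ≡ weightedSum p m g
  weightedSum-cong p m eq = Σ-cong (compositions p m) (λ {a} _ → cong (fromℕ (multinomial m a) *_) (eq a))

  weightedFamilySum-∷ : ∀ p {r} (m : Fin (suc r) → ℕ) f → weightedFamilySum p m f ≡
    weightedSum p (m zero) (λ row → weightedFamilySum p (m ∘ suc) (λ a → f (row ∷ a)))
  weightedFamilySum-∷ p m f = trans
    (Σ-cartesianProductWith _∷_ (compositions p (m zero)) (families p (m ∘ suc)) _)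
    (Σ-cong (compositions p (m zero)) λ {row} _ → trans
      (Σ-cong (families p (m ∘ suc)) (λ {a} _ → factor row a))
      (sym (Σ-*ˡ (families p (m ∘ suc)) (fromℕ (multinomial (m zero) row)) _)))
    where
    factor : ∀ row a → let k = multinomial (m zero) row
                           l = ∏ λ u → multinomial (m (suc u)) (lookup a u) in
             fromℕ (k ℕ.* l) * f (row ∷ a) ≡ fromℕ k * (fromℕ l * f (row ∷ a))
    factor row a = trans (cong (_* f (row ∷ a)) (fromℕ-* k l)) (ℚP.*-assoc (fromℕ k) (fromℕ l) (f (row ∷ a)))
      where
      k = multinomial (m zero) row
      l = ∏ λ u → multinomial (m (suc u)) (lookup a u)

  -- The row totals are only pointwise equal, so the lists `families p m` and `families p m′` are
  -- not exchanged as a whole but row by row.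
  weightedFamilySum-cong : ∀ p {r} {m m′ : Fin r → ℕ} → m ≗ m′ → ∀ {f g} → f ≗ g →
                           weightedFamilySum p m f ≡ weightedFamilySum p m′ g
  weightedFamilySum-cong p {zero}  eq f≗g = cong (λ z → 1ℚ * z + 0ℚ) (f≗g [])
  weightedFamilySum-cong p {suc r} {m} {m′} eq {f} {g} f≗g = begin
    weightedFamilySum p m f
      ≡⟨ weightedFamilySum-∷ p m f ⟩
    weightedSum p (m zero) (λ row → weightedFamilySum p (m ∘ suc) (λ a → f (row ∷ a)))
      ≡⟨ cong (λ k → weightedSum p k _) (eq zero) ⟩
    weightedSum p (m′ zero) (λ row → weightedFamilySum p (m ∘ suc) (λ a → f (row ∷ a)))
      ≡⟨ weightedSum-cong p (m′ zero) (λ row → weightedFamilySum-cong p (eq ∘ suc) (λ a → f≗g (row ∷ a))) ⟩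
    weightedSum p (m′ zero) (λ row → weightedFamilySum p (m′ ∘ suc) (λ a → g (row ∷ a)))
      ≡⟨ weightedFamilySum-∷ p m′ g ⟨
    weightedFamilySum p m′ g ∎

  noCounts : ∀ p r → Vec (Vec ℕ p) r
  noCounts p r = Vec.replicate r (Vec.replicate p 0)

  incrementAt : ∀ {p r} → Fin r → Fin p → Vec (Vec ℕ p) r → Vec (Vec ℕ p) r
  incrementAt u s a = Vec.updateAt a u (increment s)

  weightedFamilySum-zero : ∀ p r f → weightedFamilySum p {r} (λ _ → 0) f ≡ f (noCounts p r)
  weightedFamilySum-zero p zero    f = trans (ℚP.+-identityʳ _) (ℚP.*-identityˡ (f []))
  weightedFamilySum-zero p (suc r) f = begin
    weightedFamilySum p {suc r} (λ _ → 0) f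
      ≡⟨ weightedFamilySum-∷ p (λ _ → 0) f ⟩
    weightedSum p 0 (λ row → weightedFamilySum p (λ _ → 0) (λ a → f (row ∷ a)))
      ≡⟨ weightedSum-zero p _ ⟩
    weightedFamilySum p (λ _ → 0) (λ a → f (Vec.replicate p 0 ∷ a))
      ≡⟨ weightedFamilySum-zero p r _ ⟩
    f (noCounts p (suc r)) ∎

  weightedSum-∑ : ∀ p m {n} (f : Vec ℕ p → Fin n → ℚ) →
                  weightedSum p m (sum ∘ f) ≡ sum (λ i → weightedSum p m (λ a → f a i))
  weightedSum-∑ p m f = trans
    (Σ-cong (compositions p m) (λ {a} _ → *-distribˡ-sum (fromℕ (multinomial m a)) (f a)))
    (Σ-∑-comm (compositions p m) (λ a i → fromℕ (multinomial m a) * f a i))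

  -- Only row `u` grows, and `weightedSum-suc` applies to it. The new totals are written as an
  -- indicator plus `m v` because `fibreSize b` unfolds to exactly this form, with `u` the block of
  -- the first index.
  weightedFamilySum-suc : ∀ p {r} (u : Fin r) m f →
    weightedFamilySum p (λ v → 𝟙 (does (u FinP.≟ v)) ℕ.+ m v) f ≡
    sum (λ s → weightedFamilySum p m (f ∘ incrementAt u s))
  weightedFamilySum-suc p zero m f = begin
    weightedFamilySum p (λ v → 𝟙 (does (zero FinP.≟ v)) ℕ.+ m v) f
      ≡⟨ weightedFamilySum-∷ p (λ v → 𝟙 (does (zero FinP.≟ v)) ℕ.+ m v) f ⟩
    weightedSum p (suc (m zero)) (λ row → weightedFamilySum p (m ∘ suc) (λ a → f (row ∷ a)))
      ≡⟨ weightedSum-suc p (m zero) _ ⟩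
    sum (λ s → weightedSum p (m zero) (λ row → weightedFamilySum p (m ∘ suc) (λ a → f (increment s row ∷ a))))
      ≡⟨ sum-cong-≗ (λ s → weightedFamilySum-∷ p m (f ∘ incrementAt zero s)) ⟨
    sum (λ s → weightedFamilySum p m (f ∘ incrementAt zero s)) ∎
  weightedFamilySum-suc p (suc u) m f = begin
    weightedFamilySum p (λ v → 𝟙 (does (suc u FinP.≟ v)) ℕ.+ m v) f
      ≡⟨ weightedFamilySum-∷ p (λ v → 𝟙 (does (suc u FinP.≟ v)) ℕ.+ m v) f ⟩
    weightedSum p (m zero) (λ row → weightedFamilySum p (λ v → 𝟙 (does (u FinP.≟ v)) ℕ.+ m (suc v)) (λ a → f (row ∷ a)))
      ≡⟨ weightedSum-cong p (m zero) (λ row → weightedFamilySum-suc p u (m ∘ suc) (λ a → f (row ∷ a))) ⟩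
    weightedSum p (m zero) (λ row → sum (λ s → weightedFamilySum p (m ∘ suc) (λ a → f (row ∷ incrementAt u s a))))
      ≡⟨ weightedSum-∑ p (m zero) (λ row s → weightedFamilySum p (m ∘ suc) (λ a → f (row ∷ incrementAt u s a))) ⟩
    sum (λ s → weightedSum p (m zero) (λ row → weightedFamilySum p (m ∘ suc) (λ a → f (row ∷ incrementAt u s a))))
      ≡⟨ sum-cong-≗ (λ s → weightedFamilySum-∷ p m (f ∘ incrementAt (suc u) s)) ⟨
    sum (λ s → weightedFamilySum p m (f ∘ incrementAt (suc u) s)) ∎

  -- Colourings and their counts by block and colour

  colourings : ∀ p n → List (Vec (Fin p) n)
  colourings p zero    = [] ∷ []
  colourings p (suc n) = cartesianProductWith _∷_ (allFin p) (colourings p n)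

  Σ-colourings-suc : ∀ p n f → Σ[ colourings p (suc n) ] f ≡
                     sum (λ c → Σ[ colourings p n ] (λ x → f (c ∷ x)))
  Σ-colourings-suc p n f = trans (Σ-cartesianProductWith _∷_ (allFin p) (colourings p n) f)
                                 (Σ-allFin p (λ c → Σ[ colourings p n ] (λ x → f (c ∷ x))))

  fibreSize : ∀ {n r} → (Fin n → Fin r) → Fin r → ℕ
  fibreSize b u = ∑ λ i → 𝟙 (does (b i FinP.≟ u))

  -- Entry (u, s) is the number of indices of colour `s` that `b` sends to `u`. The recursive form
  -- serves the induction on n; `lookup-counts` gives the closed form.
  counts : ∀ {p n r} → (Fin n → Fin r) → Vec (Fin p) n → Vec (Vec ℕ p) r
  counts b []      = noCounts _ _
  counts b (c ∷ x) = incrementAt (b zero) c (counts (b ∘ suc) x)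

  -- Both sides satisfy the same recursion: removing the first index, of colour `c`, lowers the
  -- entry at (`b zero`, `c`) by one. Thus multinomial coefficients count colourings without an
  -- explicit bijection.
  Σ-colourings-counts : ∀ p {n r} (b : Fin n → Fin r) f →
    Σ[ colourings p n ] (f ∘ counts b) ≡ weightedFamilySum p (fibreSize b) f
  Σ-colourings-counts p {zero} {r} b f = trans (ℚP.+-identityʳ _) (sym (weightedFamilySum-zero p r f))
  Σ-colourings-counts p {suc n} b f = begin
    Σ[ colourings p (suc n) ] (f ∘ counts b)
      ≡⟨ Σ-colourings-suc p n _ ⟩
    sum (λ c → Σ[ colourings p n ] (f ∘ incrementAt (b zero) c ∘ counts (b ∘ suc)))
      ≡⟨ sum-cong-≗ (λ c → Σ-colourings-counts p (b ∘ suc) (f ∘ incrementAt (b zero) c)) ⟩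
    sum (λ c → weightedFamilySum p (fibreSize (b ∘ suc)) (f ∘ incrementAt (b zero) c))
      ≡⟨ weightedFamilySum-suc p (b zero) (fibreSize (b ∘ suc)) f ⟨
    weightedFamilySum p (fibreSize b) f ∎

-- Polynomials and colourings

module _ where
  open import Data.Rational.Base using (_+_; _*_)
  open ListSum ℚP.+-0-commutativeMonoid
  open SemiringSum (CommutativeRing.semiring ℚP.+-*-commutativeRing)
  open RawSemiringDefs (RawRing.rawSemiring ℚ[t]) using (_^_)

  coefficient-+ : ∀ f g k → coefficient (f +ᴾ g) k ≡ coefficient f k + coefficient g k
  coefficient-+ []      g       k       = sym (ℚP.+-identityˡ (coefficient g k))
  coefficient-+ (c ∷ f) []      k       = sym (ℚP.+-identityʳ (coefficient (c ∷ f) k))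
  coefficient-+ (c ∷ f) (d ∷ g) zero    = refl
  coefficient-+ (c ∷ f) (d ∷ g) (suc k) = coefficient-+ f g k

  coefficient-map : ∀ c f k → coefficient (List.map (c *_) f) k ≡ c * coefficient f k
  coefficient-map c []      k       = sym (ℚP.*-zeroʳ c)
  coefficient-map c (d ∷ f) zero    = refl
  coefficient-map c (d ∷ f) (suc k) = coefficient-map c f k

  coefficient-constant-* : ∀ c f k → coefficient (constant c *ᴾ f) k ≡ c * coefficient f k
  coefficient-constant-* c f k = begin
    coefficient (List.map (c *_) f +ᴾ (0ℚ ∷ [])) k         ≡⟨ coefficient-+ (List.map (c *_) f) (0ℚ ∷ []) k ⟩
    coefficient (List.map (c *_) f) k + coefficient (0ℚ ∷ []) k  ≡⟨ cong₂ _+_ (coefficient-map c f k) (zeros k) ⟩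
    c * coefficient f k + 0ℚ                               ≡⟨ ℚP.+-identityʳ _ ⟩
    c * coefficient f k                                    ∎
    where
    zeros : ∀ k → coefficient (0ℚ ∷ []) k ≡ 0ℚ
    zeros zero    = refl
    zeros (suc _) = refl

  -- Multiplication by t, seen on the sequence of coefficients.
  shift : (ℕ → ℚ) → ℕ → ℚ
  shift f zero    = 0ℚ
  shift f (suc k) = f k

  -- The factor t + c covers both t itself, with c = 0, and `t-1`, with c = -1.
  coefficient-linear-* : ∀ c f k →
    coefficient ((c ∷ 1ℚ ∷ []) *ᴾ f) k ≡ c * coefficient f k + shift (coefficient f) k
  coefficient-linear-* c f k = trans (coefficient-+ (List.map (c *_) f) (0ℚ ∷ constant 1ℚ *ᴾ f) k)
    (cong₂ _+_ (coefficient-map c f k) (shifted k))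
    where
    shifted : ∀ k → coefficient (0ℚ ∷ constant 1ℚ *ᴾ f) k ≡ shift (coefficient f) k
    shifted zero    = refl
    shifted (suc k) = trans (coefficient-constant-* 1ℚ f k) (ℚP.*-identityˡ (coefficient f k))

  coefficient-sumOver : ∀ {A : Set} (xs : List A) f k →
    coefficient (sumOver ℚ[t] xs f) k ≡ Σ[ xs ] (λ x → coefficient (f x) k)
  coefficient-sumOver []       f k = refl
  coefficient-sumOver (x ∷ xs) f k = trans (coefficient-+ (f x) (sumOver ℚ[t] xs f) k)
    (cong (coefficient (f x) k +_) (coefficient-sumOver xs f k))

  -- An equality of lists and not merely of coefficients, so that it can be substituted inside a
  -- product.
  constant-^ : ∀ m e → constant (fromℕ m) ^ e ≡ constant (fromℕ (m ℕ.^ e))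
  constant-^ m zero    = refl
  constant-^ m (suc e) = begin
    constant (fromℕ m) *ᴾ constant (fromℕ m) ^ e     ≡⟨ cong (constant (fromℕ m) *ᴾ_) (constant-^ m e) ⟩
    constant (fromℕ m * fromℕ (m ℕ.^ e) + 0ℚ)        ≡⟨ cong constant (trans (ℚP.+-identityʳ _) (sym (fromℕ-* m (m ℕ.^ e)))) ⟩
    constant (fromℕ (m ℕ.^ suc e))                   ∎

  t-1 : Polynomial
  t-1 = indeterminate +ᴾ List.map (ℚ.-_) (constant 1ℚ)

  -- The binomial expansion of t = 1 + (t - 1) to the power #S, one element at a time. An element
  -- outside `S` adds only zero terms. For an element of `S`, the terms with and without it add up
  -- to (t - 1)^#ℬ times t, which `combine` reads off as a shift.
  Σ-subsets : ∀ {m} (S : Subset m) k →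
    Σ[ allSubsets m ] (λ ℬ → if does (ℬ ⊆? S) then coefficient (t-1 ^ ∣ ℬ ∣) k else 0ℚ) ≡
    coefficient (indeterminate ^ ∣ S ∣) k
  Σ-subsets []      k = ℚP.+-identityʳ (coefficient (constant 1ℚ) k)
  Σ-subsets {suc m} (outside ∷ S) k = begin
    Σ[ allSubsets (suc m) ] term
      ≡⟨ Σ-++ (List.map (outside ∷_) (allSubsets m)) (List.map (inside ∷_) (allSubsets m)) term ⟩
    Σ[ List.map (outside ∷_) (allSubsets m) ] term + Σ[ List.map (inside ∷_) (allSubsets m) ] term
      ≡⟨ cong₂ _+_ (trans (Σ-map (allSubsets m) (outside ∷_) term) (Σ-subsets S k))
                   (trans (Σ-map (allSubsets m) (inside ∷_) term) (Σ-zero (allSubsets m))) ⟩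
    coefficient (indeterminate ^ ∣ S ∣) k + 0ℚ
      ≡⟨ ℚP.+-identityʳ _ ⟩
    coefficient (indeterminate ^ ∣ S ∣) k ∎
    where
    term : Subset (suc m) → ℚ
    term ℬ = if does (ℬ ⊆? outside ∷ S) then coefficient (t-1 ^ ∣ ℬ ∣) k else 0ℚ
  Σ-subsets {suc m} (inside ∷ S) k = begin
    Σ[ allSubsets (suc m) ] term
      ≡⟨ Σ-++ (List.map (outside ∷_) (allSubsets m)) (List.map (inside ∷_) (allSubsets m)) term ⟩
    Σ[ List.map (outside ∷_) (allSubsets m) ] term + Σ[ List.map (inside ∷_) (allSubsets m) ] term
      ≡⟨ cong₂ _+_ (Σ-map (allSubsets m) (outside ∷_) term) (Σ-map (allSubsets m) (inside ∷_) term) ⟩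
    Σ[ allSubsets m ] (c k) + Σ[ allSubsets m ] (term ∘ (inside ∷_))
      ≡⟨ Σ-distrib-+ (allSubsets m) (c k) (term ∘ (inside ∷_)) ⟨
    Σ[ allSubsets m ] (λ ℬ → c k ℬ + term (inside ∷ ℬ))
      ≡⟨ Σ-cong (allSubsets m) (λ {ℬ} _ → combine ℬ) ⟩
    Σ[ allSubsets m ] (λ ℬ → shift (λ k → c k ℬ) k)
      ≡⟨ shifted k ⟩
    shift (coefficient (indeterminate ^ ∣ S ∣)) k
      ≡⟨ trans (cong (_+ shift _ k) (ℚP.*-zeroˡ (coefficient (indeterminate ^ ∣ S ∣) k))) (ℚP.+-identityˡ _) ⟨
    0ℚ * coefficient (indeterminate ^ ∣ S ∣) k + shift (coefficient (indeterminate ^ ∣ S ∣)) k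
      ≡⟨ coefficient-linear-* 0ℚ (indeterminate ^ ∣ S ∣) k ⟨
    coefficient (indeterminate ^ suc ∣ S ∣) k ∎
    where
    term : Subset (suc m) → ℚ
    term ℬ = if does (ℬ ⊆? inside ∷ S) then coefficient (t-1 ^ ∣ ℬ ∣) k else 0ℚ
    c : ℕ → Subset m → ℚ
    c k ℬ = if does (ℬ ⊆? S) then coefficient (t-1 ^ ∣ ℬ ∣) k else 0ℚ
    shifted : ∀ k → Σ[ allSubsets m ] (λ ℬ → shift (λ k → c k ℬ) k) ≡ shift (coefficient (indeterminate ^ ∣ S ∣)) k
    shifted zero    = Σ-zero (allSubsets m)
    shifted (suc k) = Σ-subsets S k
    shift-zero : ∀ k → 0ℚ ≡ shift (λ _ → 0ℚ) k
    shift-zero zero    = refl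
    shift-zero (suc k) = refl
    combine : ∀ ℬ → c k ℬ + term (inside ∷ ℬ) ≡ shift (λ k → c k ℬ) k
    combine ℬ with does (ℬ ⊆? S)
    ... | false = shift-zero k
    ... | true  = begin
      u + coefficient (t-1 ^ suc ∣ ℬ ∣) k  ≡⟨ cong (u +_) (coefficient-linear-* (ℚ.- 1ℚ) (t-1 ^ ∣ ℬ ∣) k) ⟩
      u + (ℚ.- 1ℚ * u + v)                 ≡⟨ ℚP.+-assoc u (ℚ.- 1ℚ * u) v ⟨
      u + ℚ.- 1ℚ * u + v                   ≡⟨ cong (λ w → u + w + v)
            (trans (sym (ℚP.neg-distribˡ-* 1ℚ u)) (cong ℚ.-_ (ℚP.*-identityˡ u))) ⟩
      u + ℚ.- u + v                        ≡⟨ cong (_+ v) (ℚP.+-inverseʳ u) ⟩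
      0ℚ + v                               ≡⟨ ℚP.+-identityˡ v ⟩
      v                                    ∎
      where
      u = coefficient (t-1 ^ ∣ ℬ ∣) k
      v = shift (coefficient (t-1 ^ ∣ ℬ ∣)) k

  -- Colourings that are constant on the edges of a graph

  infix 4 _≟ⱽ_

  _≟ⱽ_ : ∀ {p n} (x y : Vec (Fin p) n) → Dec (x ≡ y)
  _≟ⱽ_ = VecP.≡-dec FinP._≟_

  Σ-colourings-single : ∀ {p n} (z : Vec (Fin p) n) f →
    Σ[ colourings p n ] (λ x → if does (z ≟ⱽ x) then f x else 0ℚ) ≡ f z
  Σ-colourings-single []      f = ℚP.+-identityʳ (f [])
  Σ-colourings-single {p} {suc n} (c ∷ z) f = begin
    Σ[ colourings p (suc n) ] (λ x → if does (c ∷ z ≟ⱽ x) then f x else 0ℚ)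
      ≡⟨ Σ-colourings-suc p n _ ⟩
    sum (λ d → Σ[ colourings p n ] (λ x → if does (c FinP.≟ d) ∧ does (z ≟ⱽ x) then f (d ∷ x) else 0ℚ))
      ≡⟨ sum-cong-≗ step ⟩
    sum (λ d → if does (c FinP.≟ d) then f (d ∷ z) else 0ℚ)
      ≡⟨ ∑-single c (λ d → f (d ∷ z)) ⟩
    f (c ∷ z) ∎
    where
    step : ∀ d → Σ[ colourings p n ] (λ x → if does (c FinP.≟ d) ∧ does (z ≟ⱽ x) then f (d ∷ x) else 0ℚ) ≡
                 (if does (c FinP.≟ d) then f (d ∷ z) else 0ℚ)
    step d with does (c FinP.≟ d)
    ... | true  = Σ-colourings-single z (λ x → f (d ∷ x))
    ... | false = Σ-zero (colourings p n)

  sum-const : ∀ p w → sum {p} (λ _ → w) ≡ fromℕ p * w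
  sum-const zero    w = sym (ℚP.*-zeroˡ w)
  sum-const (suc p) w = begin
    w + sum {p} (λ _ → w)       ≡⟨ cong₂ _+_ (sym (ℚP.*-identityˡ w)) (sum-const p w) ⟩
    1ℚ * w + fromℕ p * w        ≡⟨ ℚP.*-distribʳ-+ w 1ℚ (fromℕ p) ⟨
    (1ℚ + fromℕ p) * w          ≡⟨ cong (_* w) (fromℕ-+ 1 p) ⟨
    fromℕ (suc p) * w           ∎

  Σ-colourings-const : ∀ p d w → Σ[ colourings p d ] (λ _ → w) ≡ fromℕ (p ℕ.^ d) * w
  Σ-colourings-const p zero    w = trans (ℚP.+-identityʳ w) (sym (ℚP.*-identityˡ w))
  Σ-colourings-const p (suc d) w = begin
    Σ[ colourings p (suc d) ] (λ _ → w)          ≡⟨ Σ-colourings-suc p d (λ _ → w) ⟩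
    sum {p} (λ _ → Σ[ colourings p d ] (λ _ → w)) ≡⟨ sum-const p _ ⟩
    fromℕ p * Σ[ colourings p d ] (λ _ → w)      ≡⟨ cong (fromℕ p *_) (Σ-colourings-const p d w) ⟩
    fromℕ p * (fromℕ (p ℕ.^ d) * w)              ≡⟨ ℚP.*-assoc (fromℕ p) (fromℕ (p ℕ.^ d)) w ⟨
    fromℕ p * fromℕ (p ℕ.^ d) * w                ≡⟨ cong (_* w) (fromℕ-* p (p ℕ.^ d)) ⟨
    fromℕ (p ℕ.^ suc d) * w                      ∎

  Respects : ∀ {p n} → List (Fin n × Fin n) → Vec (Fin p) n → Set
  Respects edges x = ∀ {i j} → (i , j) ∈ₗ edges → lookup x i ≡ lookup x j

  -- Such colourings are the colourings of the `d` components, pulled back along `class`; values are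
  -- constant along paths, so restricting to representatives inverts `spread`. The change of
  -- variables is a double sum over the pairs with `spread y ≡ x`, evaluated in both orders.
  Σ-respecting : ∀ {p n d} {edges : List (Fin n × Fin n)} → Components edges d →
    {P : Vec (Fin p) n → Set} (P? : ∀ x → Dec (P x)) → (∀ x → P x ⇔ Respects edges x) → ∀ w →
    Σ[ colourings p n ] (λ x → if does (P? x) then w else 0ℚ) ≡ fromℕ (p ℕ.^ d) * w
  Σ-respecting {p} {n} {d} {edges} G {P} P? P⇔ w = begin
    Σ[ colourings p n ] (λ x → if does (P? x) then w else 0ℚ)
      ≡⟨ Σ-cong (colourings p n) (λ {x} _ → expand x) ⟩
    Σ[ colourings p n ] (λ x → Σ[ colourings p d ] (λ y → if does (spread y ≟ⱽ x) then w else 0ℚ))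
      ≡⟨ Σ-comm (colourings p n) (colourings p d) (λ x y → if does (spread y ≟ⱽ x) then w else 0ℚ) ⟩
    Σ[ colourings p d ] (λ y → Σ[ colourings p n ] (λ x → if does (spread y ≟ⱽ x) then w else 0ℚ))
      ≡⟨ Σ-cong (colourings p d) (λ {y} _ → Σ-colourings-single (spread y) (λ _ → w)) ⟩
    Σ[ colourings p d ] (λ _ → w)
      ≡⟨ Σ-colourings-const p d w ⟩
    fromℕ (p ℕ.^ d) * w ∎
    where
    open Components G
    spread : Vec (Fin p) d → Vec (Fin p) n
    spread y = tabulate (lookup y ∘ class)
    restrict : Vec (Fin p) n → Vec (Fin p) d
    restrict x = tabulate (lookup x ∘ rep)

    spread-restrict : ∀ x → Respects edges x → spread (restrict x) ≡ x
    spread-restrict x resp = trans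
      (VecP.tabulate-cong λ u → trans (VecP.lookup∘tabulate (lookup x ∘ rep) (class u))
        (sym (EqC.gfold isEquivalence (lookup x) resp (connected u))))
      (VecP.tabulate∘lookup x)

    restrict-spread : ∀ y → restrict (spread y) ≡ y
    restrict-spread y = trans
      (VecP.tabulate-cong λ k → trans (VecP.lookup∘tabulate (lookup y ∘ class) (rep k)) (cong (lookup y) (class-rep k)))
      (VecP.tabulate∘lookup y)

    spread-respects : ∀ y → Respects edges (spread y)
    spread-respects y {i} {j} e = trans (VecP.lookup∘tabulate (lookup y ∘ class) i)
      (trans (cong (lookup y) (respects e)) (sym (VecP.lookup∘tabulate (lookup y ∘ class) j)))

    -- For a fixed `x` there is at most one preimage, namely `restrict x`, and it is one exactly
    -- when `x` satisfies `P`. So the inner sum over `y` collapses to the indicator of `P x`.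
    equivalent : ∀ x y → spread y ≡ x ⇔ (restrict x ≡ y × P x)
    equivalent x y = mk⇔
      (λ { refl → restrict-spread y , Equivalence.from (P⇔ _) (spread-respects y) })
      (λ { (refl , Px) → spread-restrict x (Equivalence.to (P⇔ x) Px) })

    expand : ∀ x → (if does (P? x) then w else 0ℚ) ≡ Σ[ colourings p d ] (λ y → if does (spread y ≟ⱽ x) then w else 0ℚ)
    expand x = trans (sym (Σ-colourings-single (restrict x) (λ _ → if does (P? x) then w else 0ℚ)))
      (Σ-cong (colourings p d) λ {y} _ → trans (nested (does (restrict x ≟ⱽ y)))
        (cong (if_then w else 0ℚ) (sym (does-⇔ (equivalent x y) (spread y ≟ⱽ x) ((restrict x ≟ⱽ y) ×-dec P? x)))))
      where
      nested : ∀ b → (if b then (if does (P? x) then w else 0ℚ) else 0ℚ) ≡ (if b ∧ does (P? x) then w else 0ℚ)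
      nested true  = refl
      nested false = refl

-- Counting the monochromatic edges

module _ where
  open import Data.Nat.Base using (_+_; _*_)
  open SemiringSum ℕP.+-*-semiring
  open ℕSolver.+-*-Solver

  ∑-if-≟ : ∀ {n} (i : Fin n) (h : Fin n → ℕ) → ∑ (λ j → 𝟙 (does (i FinP.≟ j)) * h j) ≡ h i
  ∑-if-≟ {suc n} zero    h = trans (cong₂ _+_ (ℕP.*-identityˡ (h zero)) (sum-replicate-zero n)) (ℕP.+-identityʳ (h zero))
  ∑-if-≟ {suc n} (suc i) h = ∑-if-≟ i (h ∘ suc)

  ∑-fibre : ∀ {n r} (b : Fin n → Fin r) (k : Fin n → ℕ) (h : Fin r → ℕ) →
            ∑ (λ u → ∑ (λ i → 𝟙 (does (b i FinP.≟ u)) * k i) * h u) ≡ ∑ (λ i → k i * h (b i))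
  ∑-fibre b k h = begin
    ∑ (λ u → ∑ (λ i → 𝟙 (does (b i FinP.≟ u)) * k i) * h u)
      ≡⟨ sum-cong-≗ (λ u → *-distribʳ-sum (h u) (λ i → 𝟙 (does (b i FinP.≟ u)) * k i)) ⟩
    ∑ (λ u → ∑ (λ i → 𝟙 (does (b i FinP.≟ u)) * k i * h u))
      ≡⟨ ∑-comm (λ u i → 𝟙 (does (b i FinP.≟ u)) * k i * h u) ⟩
    ∑ (λ i → ∑ (λ u → 𝟙 (does (b i FinP.≟ u)) * k i * h u))
      ≡⟨ sum-cong-≗ (λ i → trans (sum-cong-≗ (λ u → ℕP.*-assoc (𝟙 (does (b i FinP.≟ u))) (k i) (h u)))
                                 (∑-if-≟ (b i) (λ u → k i * h u))) ⟩
    ∑ (λ i → k i * h (b i)) ∎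

  ∑< : ∀ {n} → (Fin n → Fin n → ℕ) → ℕ
  ∑< g = ∑ λ i → ∑ λ j → if does (i FinP.<? j) then g i j else 0

  ∑-symmetric : ∀ {n} (g : Fin n → Fin n → ℕ) → (∀ i j → g i j ≡ g j i) →
                ∑ (λ i → ∑ (g i)) ≡ ∑ (λ i → g i i) + (∑< g + ∑< g)
  ∑-symmetric g g-sym = begin
    ∑ (λ i → ∑ (g i))
      ≡⟨ sum-cong-≗ (λ i → trans (sum-cong-≗ (split i))
           (trans (∑-distrib-+ (diag i) (λ j → upper i j + upper j i))
             (cong₂ _+_ (∑-if-≟ i (g i)) (∑-distrib-+ (upper i) (λ j → upper j i))))) ⟩
    ∑ (λ i → g i i + (∑ (upper i) + ∑ (λ j → upper j i)))
      ≡⟨ trans (∑-distrib-+ (λ i → g i i) _) (cong (∑ (λ i → g i i) +_) (∑-distrib-+ (∑ ∘ upper) (λ i → ∑ (λ j → upper j i)))) ⟩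
    ∑ (λ i → g i i) + (∑< g + ∑ (λ i → ∑ (λ j → upper j i)))
      ≡⟨ cong (λ z → ∑ (λ i → g i i) + (∑< g + z)) (∑-comm upper) ⟨
    ∑ (λ i → g i i) + (∑< g + ∑< g) ∎
    where
    diag upper : _ → _ → ℕ
    diag i j = 𝟙 (does (i FinP.≟ j)) * g i j
    upper i j = if does (i FinP.<? j) then g i j else 0
    split : ∀ i j → g i j ≡ diag i j + (upper i j + upper j i)
    split i j with FinP.<-cmp i j
    ... | tri< i<j i≢j j≮i
      rewrite dec-true (i FinP.<? j) i<j | dec-false (i FinP.≟ j) i≢j | dec-false (j FinP.<? i) j≮i
      = sym (ℕP.+-identityʳ (g i j))
    ... | tri≈ i≮j i≡j j≮i
      rewrite dec-false (i FinP.<? j) i≮j | dec-true (i FinP.≟ j) i≡j | dec-false (j FinP.<? i) j≮i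
      = sym (trans (ℕP.+-identityʳ _) (ℕP.+-identityʳ (g i j)))
    ... | tri> i≮j i≢j j<i
      rewrite dec-false (i FinP.<? j) i≮j | dec-false (i FinP.≟ j) i≢j | dec-true (j FinP.<? i) j<i
      = g-sym i j

  -- Among the ordered pairs from k elements, k lie on the diagonal and each two-element set occurs
  -- twice. This is the source of the binomials in the exponent.
  square : ∀ k → k * k ≡ k + ((k C 2) + (k C 2))
  square zero    = refl
  square (suc k) = begin
    suc k * suc k
      ≡⟨ solve 1 (λ x → (con 1 :+ x) :* (con 1 :+ x) := con 1 :+ x :+ x :+ x :* x) refl k ⟩
    1 + k + k + k * k
      ≡⟨ cong (1 + k + k +_) (square k) ⟩
    1 + k + k + (k + ((k C 2) + (k C 2)))
      ≡⟨ solve 2 (λ x c → con 1 :+ x :+ x :+ (x :+ (c :+ c)) := con 1 :+ x :+ ((x :+ c) :+ (x :+ c))) refl k (k C 2) ⟩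
    suc k + ((k + (k C 2)) + (k + (k C 2)))
      ≡⟨ cong (λ c → suc k + (c + c)) (trans (cong (_+ (k C 2)) (sym (nC1≡n k))) (nCk+nC[k+1]≡[n+1]C[k+1] k 1)) ⟩
    suc k + ((suc k C 2) + (suc k C 2)) ∎

  module _ {n r p} (b : Fin n → Fin r) (x : Fin n → Fin p)
           (adj : Fin r → Fin r → Bool) (adj-refl : ∀ u → adj u u ≡ true) (adj-sym : ∀ u v → adj u v ≡ adj v u)
    where

    count : Fin r → Fin p → ℕ
    count u s = ∑ λ i → 𝟙 (does (b i FinP.≟ u)) * 𝟙 (does (x i FinP.≟ s))

    private
      pair : Fin n → Fin n → ℕ
      pair i j = 𝟙 (adj (b i) (b j)) * 𝟙 (does (x i FinP.≟ x j))

      -- The number of ordered pairs of indices of colour `s` from blocks `u` and `v`, counted when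
      -- the blocks are adjacent.
      weight : Fin p → Fin r → Fin r → ℕ
      weight s u v = count u s * (𝟙 (adj u v) * count v s)

      does-≟-sym : ∀ {m} (i j : Fin m) → does (i FinP.≟ j) ≡ does (j FinP.≟ i)
      does-≟-sym i j with i FinP.≟ j
      ... | yes i≡j = sym (dec-true (j FinP.≟ i) (sym i≡j))
      ... | no  i≢j = sym (dec-false (j FinP.≟ i) (i≢j ∘ sym))

      row : ∀ s u → ∑ (λ v → 𝟙 (adj u v) * count v s) ≡
                    ∑ (λ j → 𝟙 (does (x j FinP.≟ s)) * 𝟙 (adj u (b j)))
      row s u = trans (sum-cong-≗ (λ v → ℕP.*-comm (𝟙 (adj u v)) (count v s)))
                      (∑-fibre b (λ j → 𝟙 (does (x j FinP.≟ s))) (λ v → 𝟙 (adj u v)))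

      -- Double counting of the ordered pairs (i, j), with i = j allowed, that share a colour and
      -- lie in adjacent blocks: grouped by colour and blocks on the left, by index on the right.
      weights≡pairs : ∑ (λ s → ∑ (λ u → ∑ (weight s u))) ≡ ∑ (λ i → ∑ (pair i))
      weights≡pairs = begin
        ∑ (λ s → ∑ (λ u → ∑ (weight s u)))
          ≡⟨ sum-cong-≗ (λ s → sum-cong-≗ (λ u → trans
               (sym (*-distribˡ-sum (count u s) (λ v → 𝟙 (adj u v) * count v s))) (cong (count u s *_) (row s u)))) ⟩
        ∑ (λ s → ∑ (λ u → count u s * ∑ (λ j → 𝟙 (does (x j FinP.≟ s)) * 𝟙 (adj u (b j)))))
          ≡⟨ sum-cong-≗ (λ s → ∑-fibre b (λ i → 𝟙 (does (x i FinP.≟ s)))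
                (λ u → ∑ (λ j → 𝟙 (does (x j FinP.≟ s)) * 𝟙 (adj u (b j))))) ⟩
        ∑ (λ s → ∑ (λ i → 𝟙 (does (x i FinP.≟ s)) * ∑ (λ j → 𝟙 (does (x j FinP.≟ s)) * 𝟙 (adj (b i) (b j)))))
          ≡⟨ ∑-comm (λ s i → 𝟙 (does (x i FinP.≟ s)) * ∑ (λ j → 𝟙 (does (x j FinP.≟ s)) * 𝟙 (adj (b i) (b j)))) ⟩
        ∑ (λ i → ∑ (λ s → 𝟙 (does (x i FinP.≟ s)) * ∑ (λ j → 𝟙 (does (x j FinP.≟ s)) * 𝟙 (adj (b i) (b j)))))
          ≡⟨ sum-cong-≗ (λ i → ∑-if-≟ (x i) (λ s → ∑ (λ j → 𝟙 (does (x j FinP.≟ s)) * 𝟙 (adj (b i) (b j))))) ⟩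
        ∑ (λ i → ∑ (λ j → 𝟙 (does (x j FinP.≟ x i)) * 𝟙 (adj (b i) (b j))))
          ≡⟨ sum-cong-≗ (λ i → sum-cong-≗ (λ j → trans
               (cong (λ c → 𝟙 c * 𝟙 (adj (b i) (b j))) (does-≟-sym (x j) (x i)))
               (ℕP.*-comm (𝟙 (does (x i FinP.≟ x j))) (𝟙 (adj (b i) (b j)))))) ⟩
        ∑ (λ i → ∑ (pair i)) ∎

      pairs : ∑ (λ i → ∑ (pair i)) ≡ ∑ {n} (λ _ → 1) + (∑< pair + ∑< pair)
      pairs = trans (∑-symmetric pair pair-sym) (cong (_+ (∑< pair + ∑< pair)) (sum-cong-≗ pair-refl))
        where
        pair-sym : ∀ i j → pair i j ≡ pair j i
        pair-sym i j = cong₂ (λ c d → 𝟙 c * 𝟙 d) (adj-sym (b i) (b j)) (does-≟-sym (x i) (x j))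
        pair-refl : ∀ i → pair i i ≡ 1
        pair-refl i = cong₂ (λ c d → 𝟙 c * 𝟙 d) (adj-refl (b i)) (dec-true (x i FinP.≟ x i) refl)

      total : ∑ (λ s → ∑ (λ u → count u s)) ≡ ∑ {n} (λ _ → 1)
      total = begin
        ∑ (λ s → ∑ (λ u → count u s))
          ≡⟨ sum-cong-≗ (λ s → trans (sum-cong-≗ (λ u → sym (ℕP.*-identityʳ (count u s))))
                (∑-fibre b (λ i → 𝟙 (does (x i FinP.≟ s))) (λ _ → 1))) ⟩
        ∑ (λ s → ∑ (λ i → 𝟙 (does (x i FinP.≟ s)) * 1))
          ≡⟨ ∑-comm (λ s i → 𝟙 (does (x i FinP.≟ s)) * 1) ⟩
        ∑ (λ i → ∑ (λ s → 𝟙 (does (x i FinP.≟ s)) * 1))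
          ≡⟨ sum-cong-≗ (λ i → ∑-if-≟ (x i) (λ _ → 1)) ⟩
        ∑ {n} (λ _ → 1) ∎

      -- The matrix of weights is symmetric, and by reflexivity of `adj` its diagonal entries are
      -- the squares of the counts. Everything beyond the linear term therefore occurs twice.
      weights : ∀ s → ∑ (λ u → ∑ (weight s u)) ≡
        ∑ (λ u → count u s) + ((∑ (λ u → count u s C 2) + ∑< (weight s)) + (∑ (λ u → count u s C 2) + ∑< (weight s)))
      weights s = begin
        ∑ (λ u → ∑ (weight s u))
          ≡⟨ ∑-symmetric (weight s) weight-sym ⟩
        ∑ (λ u → weight s u u) + (∑< (weight s) + ∑< (weight s))
          ≡⟨ cong (_+ (∑< (weight s) + ∑< (weight s))) (trans (sum-cong-≗ diag)
               (trans (∑-distrib-+ (λ u → count u s) _) (cong (∑ (λ u → count u s) +_) (∑-distrib-+ (λ u → count u s C 2) _)))) ⟩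
        (∑ (λ u → count u s) + (∑ (λ u → count u s C 2) + ∑ (λ u → count u s C 2))) + (∑< (weight s) + ∑< (weight s))
          ≡⟨ solve 3 (λ a c e → (a :+ (c :+ c)) :+ (e :+ e) := a :+ ((c :+ e) :+ (c :+ e)))
                refl (∑ (λ u → count u s)) (∑ (λ u → count u s C 2)) (∑< (weight s)) ⟩
        _ ∎
        where
        weight-sym : ∀ u v → weight s u v ≡ weight s v u
        weight-sym u v = trans (cong (λ c → count u s * (𝟙 c * count v s)) (adj-sym u v))
          (solve 3 (λ x y z → x :* (y :* z) := z :* (y :* x)) refl (count u s) (𝟙 (adj v u)) (count v s))
        diag : ∀ u → weight s u u ≡ count u s + ((count u s C 2) + (count u s C 2))
        diag u = trans (cong (λ c → count u s * (𝟙 c * count u s)) (adj-refl u))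
          (trans (cong (count u s *_) (ℕP.*-identityˡ (count u s))) (square (count u s)))

      upper : ∀ u s → ∑ (λ v → if does (u FinP.<? v) then weight s u v else 0) ≡
                      count u s * ∑ (λ v → if does (u FinP.<? v) ∧ adj u v then count v s else 0)
      upper u s = trans (sum-cong-≗ eq)
            (sym (*-distribˡ-sum (count u s) (λ v → if does (u FinP.<? v) ∧ adj u v then count v s else 0)))
        where
        eq : ∀ v → (if does (u FinP.<? v) then weight s u v else 0) ≡
                   count u s * (if does (u FinP.<? v) ∧ adj u v then count v s else 0)
        eq v with does (u FinP.<? v) | adj u v
        ... | true  | true  = cong (count u s *_) (ℕP.*-identityˡ (count v s))
        ... | true  | false = refl
        ... | false | _     = sym (ℕP.*-zeroʳ (count u s))

      double-cancel : ∀ {a e f} → a + (e + e) ≡ a + (f + f) → e ≡ f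
      double-cancel {a} {e} {f} eq = ℕP.*-cancelˡ-≡ e f 2
        (trans (cong (e +_) (ℕP.+-identityʳ e)) (trans (ℕP.+-cancelˡ-≡ a _ _ eq) (sym (cong (f +_) (ℕP.+-identityʳ f)))))

    -- Both counts of ordered pairs equal n plus a doubled quantity: the pairs i < j in one case,
    -- the sum of `half s` over the colours in the other. Cancelling leaves the claim up to the
    -- order of the sums over blocks and colours.
    ∑<-pairs : ∑< (λ i j → 𝟙 (adj (b i) (b j)) * 𝟙 (does (x i FinP.≟ x j))) ≡
      ∑ (λ u → ∑ (λ s → (count u s C 2) + count u s * ∑ (λ v → if does (u FinP.<? v) ∧ adj u v then count v s else 0)))
    ∑<-pairs = trans (double-cancel {∑ {n} (λ _ → 1)} (begin
      ∑ {n} (λ _ → 1) + (∑< pair + ∑< pair)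
        ≡⟨ pairs ⟨
      ∑ (λ i → ∑ (pair i))
        ≡⟨ weights≡pairs ⟨
      ∑ (λ s → ∑ (λ u → ∑ (weight s u)))
        ≡⟨ trans (sum-cong-≗ weights) (trans (∑-distrib-+ (λ s → ∑ (λ u → count u s)) _)
             (cong₂ _+_ total (∑-distrib-+ half half))) ⟩
      ∑ {n} (λ _ → 1) + (∑ half + ∑ half) ∎))
      (trans (sum-cong-≗ (λ s → trans (sym (∑-distrib-+ (λ u → count u s C 2) _))
                                       (sum-cong-≗ (λ u → cong ((count u s C 2) +_) (upper u s)))))
             (∑-comm (λ s u → (count u s C 2) + count u s * ∑ (λ v → if does (u FinP.<? v) ∧ adj u v then count v s else 0))))
      where
      half : Fin p → ℕ
      half s = ∑ (λ u → count u s C 2) + ∑< (weight s)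

  lookup-counts : ∀ {p n r} (b : Fin n → Fin r) (x : Vec (Fin p) n) u s →
    lookup (lookup (counts b x) u) s ≡
    ∑ (λ i → 𝟙 (does (b i FinP.≟ u)) * 𝟙 (does (lookup x i FinP.≟ s)))
  lookup-counts {p} {r = r} b [] u s = trans (cong (λ row → lookup row s) (VecP.lookup-replicate u (Vec.replicate p 0)))
      (VecP.lookup-replicate s 0)
  lookup-counts b (c ∷ x) u s with b zero FinP.≟ u
  ... | no b₀≢u = trans
    (cong (λ row → lookup row s) (VecP.lookup∘updateAt′ u (b zero) (b₀≢u ∘ sym) (counts (b ∘ suc) x)))
    (lookup-counts (b ∘ suc) x u s)
  ... | yes refl = trans (cong (λ row → lookup row s) (VecP.lookup∘updateAt u (counts (b ∘ suc) x))) step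
    where
    a = lookup (counts (b ∘ suc) x) u
    -- Once the first index is known to lie in block `u`, the leading product with 1 has reduced to
    -- `𝟙 (does (c FinP.≟ s)) + 0`.
    step : lookup (increment c a) s ≡ 𝟙 (does (c FinP.≟ s)) + 0 + _
    step with c FinP.≟ s
    ... | yes refl = trans (VecP.lookup∘updateAt c a) (cong suc (lookup-counts (b ∘ suc) x u s))
    ... | no c≢s   = trans (VecP.lookup∘updateAt′ s c (c≢s ∘ sym) a) (lookup-counts (b ∘ suc) x u s)

  module _ {n r p} (b : Fin n → Fin r) (x : Vec (Fin p) n)
           (adj : Fin r → Fin r → Bool) (adj-refl : ∀ u → adj u u ≡ true) (adj-sym : ∀ u v → adj u v ≡ adj v u)
           (later : Fin r → Subset r) (lookup-later : ∀ u v → lookup (later u) v ≡ does (u FinP.<? v) ∧ adj u v)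
    where
    private
      a : Fin r → Fin p → ℕ
      a u s = lookup (lookup (counts b x) u) s

      c : Fin r → Fin p → ℕ
      c = count b (lookup x) adj adj-refl adj-sym

      a≡c : ∀ u s → a u s ≡ c u s
      a≡c = lookup-counts b x

    ∑<-monochromatic : ∑< (λ i j → 𝟙 (adj (b i) (b j)) * 𝟙 (does (lookup x i FinP.≟ lookup x j))) ≡
      ∑ (λ u → ∑ (λ s → (a u s C 2) + a u s * ∑∈ (later u) (λ v → a v s)))
    ∑<-monochromatic = trans (∑<-pairs b (lookup x) adj adj-refl adj-sym)
      (sum-cong-≗ λ u → sum-cong-≗ λ s → cong₂ (λ k l → (k C 2) + k * l) (sym (a≡c u s))
        (sum-cong-≗ λ v → cong₂ (λ d k → if d then k else 0) (sym (lookup-later u v)) (sym (a≡c v s))))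

-- Signatures and blocks

does⇒ : ∀ {P : Set} (P? : Dec P) → does P? ≡ true → P
does⇒ (yes p) _ = p

∈-tabulate : ∀ {n} {P : Pred (Fin n) 0ℓ} (P? : Decidable P) u → u ∈ tabulate (does ∘ P?) ⇔ P u
∈-tabulate P? u = mk⇔
  (λ u∈ → does⇒ (P? u) (trans (sym (VecP.lookup∘tabulate (does ∘ P?) u)) (VecP.[]=⇒lookup u∈)))
  (λ Pu → VecP.lookup⇒[]= u _ (trans (VecP.lookup∘tabulate (does ∘ P?) u) (dec-true (P? u) Pu)))

∣∣≡∑ : ∀ {n} (S : Subset n) → ∣ S ∣ ≡ ∑ (λ i → 𝟙 (lookup S i))
∣∣≡∑ []            = refl
∣∣≡∑ (inside ∷ S)  = cong suc (∣∣≡∑ S)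
∣∣≡∑ (outside ∷ S) = ∣∣≡∑ S

minimum : ∀ {n} (S : Subset n) → Nonempty S → ∃[ u ] (u ∈ S × (∀ {v} → v ∈ S → u Fin.≤ v))
minimum (inside ∷ S)  _                  = zero , here , λ _ → z≤n
minimum (outside ∷ S) (suc u , there u∈) with minimum S (u , u∈)
... | m , m∈ , least = suc m , there m∈ , λ { (there v∈) → s≤s (least v∈) }

module _ {n : ℕ} {I : Pred (Root n) 0ℓ} (I? : Decidable I) where

  private
    -- A termination measure for the ascent in `maximal-above`: it drops whenever the interval from
    -- i to j is properly enlarged.
    depth : Root n → ℕ
    depth (root i j _) = toℕ i ℕ.+ (n ∸ toℕ j)

    depth-< : ∀ α β → α ≼ β → β ≢ α → depth β ℕ.< depth α
    depth-< (root i j _) (root i′ j′ _) (i′≤i , j≤j′) β≢α with i′ FinP.≟ i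
    ... | no  i′≢i = ℕP.+-mono-<-≤ (ℕP.≤∧≢⇒< i′≤i (i′≢i ∘ FinP.toℕ-injective)) (ℕP.∸-monoʳ-≤ n j≤j′)
    ... | yes refl = ℕP.+-monoʳ-< (toℕ i) (ℕP.∸-monoʳ-< (ℕP.≤∧≢⇒< j≤j′ j≢j′) (ℕP.<⇒≤ (FinP.toℕ<n j′)))
      where
      j≢j′ : toℕ j ≢ toℕ j′
      j≢j′ eq = β≢α (root-≡ refl (sym (FinP.toℕ-injective eq)))

    ≼-refl : (α : Root n) → α ≼ α
    ≼-refl (root i j _) = ℕP.≤-refl , ℕP.≤-refl

    ≼-trans : (α β γ : Root n) → α ≼ β → β ≼ γ → α ≼ γ
    ≼-trans (root _ _ _) (root _ _ _) (root _ _ _) (p , q) (p′ , q′) = ℕP.≤-trans p′ p , ℕP.≤-trans q q′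

  maximal-above : ∀ {α} → ¬ I α → ∃[ β ] (IsMaximal I? β × α ≼ β)
  maximal-above {α} α∉I = go α α∉I (<-wellFounded (depth α))
    where
    go : ∀ α → ¬ I α → Acc ℕ._<_ (depth α) → ∃[ β ] (IsMaximal I? β × α ≼ β)
    go α α∉I (acc rs) with Any.any? (λ β → ¬? (I? β) ×-dec ((α ≼? β) ×-dec ¬? (β ≟ᴿ α))) (positiveRoots n)
    ... | yes larger = let β , _ , β∉I , α≼β , β≢α = find larger
                           γ , max , β≼γ = go β β∉I (rs (depth-< α β α≼β β≢α))
                       in γ , max , ≼-trans α β γ α≼β β≼γ
    ... | no  none   = α , (α∉I , maximal) , ≼-refl α
      where
      maximal : ∀ β → ¬ I β → α ≼ β → β ≡ α
      maximal β β∉I α≼β with β ≟ᴿ α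
      ... | yes eq = eq
      ... | no  ne = contradiction (lose (∈-positiveRoots β) (β∉I , α≼β , ne)) none

  private
    M : List (Root n)
    M = maximalElements I?

  ∈-signature : ∀ u l → l ∈ signature I? u ⇔
    (Root.i (List.lookup M l) Fin.≤ u × u Fin.≤ Root.j (List.lookup M l))
  ∈-signature u = ∈-tabulate (λ l →
    (Root.i (List.lookup M l) FinP.≤? u) ×-dec (u FinP.≤? Root.j (List.lookup M l)))

  -- A maximal root above `α` spans an interval containing that of `α`, so its position `l` in the
  -- list of maximal elements lies in all these signatures at once.
  common-signature : ∀ {α} → ¬ I α → ∃[ l ] (∀ u → Root.i α Fin.≤ u → u Fin.≤ Root.j α → l ∈ signature I? u)
  common-signature {α} α∉I = l , λ u i≤u u≤j → Equivalence.from (∈-signature u l)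
    (subst (λ γ → Root.i γ Fin.≤ u × u Fin.≤ Root.j γ) lookup-l
      (ℕP.≤-trans (proj₁ α≼β) i≤u , ℕP.≤-trans u≤j (proj₂ α≼β)))
    where
    β = proj₁ (maximal-above α∉I)
    max = proj₁ (proj₂ (maximal-above α∉I))
    α≼β : α ≼ β
    α≼β = proj₂ (proj₂ (maximal-above α∉I))
    β∈ : β ∈ₗ M
    β∈ = ∈-filter⁺ (isMaximal? I?) (∈-positiveRoots β) max
    l = Any.index β∈
    lookup-l : β ≡ List.lookup M l
    lookup-l = AnyP.lookup-index β∈

  -- A common element of the signatures names a maximal element of the complement whose interval
  -- contains both i and j, hence a root above the given one. If the given root were in `I`, the
  -- ideal property would put that maximal element in `I` as well.
  ∉I⇔signatures-meet : IsIdeal I → ∀ i j (i<j : i Fin.< j) →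
    (¬ I (root i j i<j)) ⇔ Nonempty (signature I? i ∩ signature I? j)
  ∉I⇔signatures-meet ideal i j i<j = mk⇔ to from
    where
    to : ¬ I (root i j i<j) → Nonempty (signature I? i ∩ signature I? j)
    to ∉I = let l , l∈ = common-signature ∉I in
      l , x∈p∩q⁺ (l∈ i ℕP.≤-refl (ℕP.<⇒≤ i<j) , l∈ j (ℕP.<⇒≤ i<j) ℕP.≤-refl)
    from : Nonempty (signature I? i ∩ signature I? j) → ¬ I (root i j i<j)
    from (l , l∈) α∈I =
      let l∈i , l∈j = x∈p∩q⁻ (signature I? i) (signature I? j) l∈ in
      proj₁ (proj₂ (∈-filter⁻ (isMaximal? I?) {xs = positiveRoots n} (∈-lookup l)))
        (ideal α∈I ( proj₁ (Equivalence.to (∈-signature i l) l∈i)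
                   , proj₂ (Equivalence.to (∈-signature j l) l∈j)))

-- Every index is an end of a simple root: the first of the root to its right, which exists because
-- n is at least 2, any other of the root to its left. Consequently a block is adjacent to itself,
-- and all pairs inside a block are edges.
signature-nonempty : ∀ {n} → 2 ≤ n → {I : Pred (Root n) 0ℓ} (I? : Decidable I) →
                     HasFullComplement I → ∀ u → Nonempty (signature I? u)
signature-nonempty (s≤s (s≤s _)) I? full zero =
  let l , l∈ = common-signature I? (full (root zero (suc zero) (s≤s z≤n)) refl)
  in  l , l∈ zero z≤n z≤n
signature-nonempty (s≤s (s≤s _)) I? full (suc u) =
  let l , l∈ = common-signature I? (full (root (inject₁ u) (suc u) u<1+u) (cong suc (sym (FinP.toℕ-inject₁ u))))
  in  l , l∈ (suc u) (ℕP.<⇒≤ u<1+u) ℕP.≤-refl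
  where
  u<1+u : inject₁ u Fin.< suc u
  u<1+u = s≤s (ℕP.≤-reflexive (FinP.toℕ-inject₁ u))

-- The blocks of the partition as fibres of a map on the indices

module _ {n : ℕ} {I : Pred (Root n) 0ℓ} {I? : Decidable I} (P : AccordantPartition I?) where
  open AccordantPartition P

  private
    signature≟ : (σ τ : Signature I?) → Dec (σ ≡ τ)
    signature≟ = VecP.≡-dec Bool._≟_

    signatureClass : Fin n → Subset n
    signatureClass x = tabulate (λ v → does (signature≟ (signature I? v) (signature I? x)))

    ∈-class : ∀ x v → v ∈ signatureClass x ⇔ signature I? v ≡ signature I? x
    ∈-class x = ∈-tabulate (λ v → signature≟ (signature I? v) (signature I? x))

    class-constant : ∀ x → IsConstantOn I? (signatureClass x)
    class-constant x u∈ v∈ = trans (Equivalence.to (∈-class x _) u∈) (sym (Equivalence.to (∈-class x _) v∈))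

    class-isBlock : ∀ x → IsBlock I? (signatureClass x)
    class-isBlock x = (x , x∈) , class-constant x , λ B constant ⊆B v∈B →
      Equivalence.from (∈-class x _) (constant v∈B (⊆B x∈))
      where
      x∈ : x ∈ signatureClass x
      x∈ = Equivalence.from (∈-class x x) refl

    -- Constancy puts `B` inside the class of `x`; the class is itself constant, so maximality of
    -- `B` gives the other inclusion.
    block≡class : ∀ {B x} → IsBlock I? B → x ∈ B → B ≡ signatureClass x
    block≡class {B} {x} (_ , constant , maximal) x∈B =
          ⊆-antisym ⊆class (maximal (signatureClass x) (class-constant x) ⊆class)
      where
      ⊆class : B ⊆ signatureClass x
      ⊆class v∈B = Equivalence.from (∈-class x _) (constant v∈B x∈B)

    -- `exhaustive` provides an index for each block but not its uniqueness. That follows from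
    -- `increasing`: two indices of one block would make its minimum smaller than itself.
    A-injective : ∀ {u v} → A u ≡ A v → u ≡ v
    A-injective {u} {v} eq with FinP.<-cmp u v
    ... | tri≈ _ u≡v _ = u≡v
    ... | tri< u<v _ _ = contradiction (increasing u<v min (subst (λ S → IsMinimumOf I? S (proj₁ least)) eq min))
          (ℕP.<-irrefl refl)
      where
      least = minimum (A u) (proj₁ (isBlock u))
      min = proj₂ least
    ... | tri> _ _ v<u = contradiction (increasing v<u (subst (λ S → IsMinimumOf I? S (proj₁ least)) eq min) min)
          (ℕP.<-irrefl refl)
      where
      least = minimum (A u) (proj₁ (isBlock u))
      min = proj₂ least

  blockOf : Fin n → Fin r
  blockOf x = proj₁ (exhaustive _ (class-isBlock x))

  ∈-A : ∀ u x → x ∈ A u ⇔ blockOf x ≡ u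
  ∈-A u x = mk⇔ (λ x∈ → A-injective (trans A-blockOf (sym (block≡class (isBlock u) x∈)))) (λ { refl → x∈A })
    where
    A-blockOf : A (blockOf x) ≡ signatureClass x
    A-blockOf = proj₂ (exhaustive _ (class-isBlock x))
    x∈A : x ∈ A (blockOf x)
    x∈A = subst (x ∈_) (sym A-blockOf) (Equivalence.from (∈-class x x) refl)

  ∣A∣≡fibreSize : ∀ u → ∣ A u ∣ ≡ fibreSize blockOf u
  ∣A∣≡fibreSize u = trans (∣∣≡∑ (A u)) (ℕΣ.sum-cong-≗ λ x → cong 𝟙 (eq x))
    where
    lookup-∈? : ∀ {m} (S : Subset m) x → lookup S x ≡ does (x ∈? S)
    lookup-∈? (inside ∷ S)  zero    = refl
    lookup-∈? (outside ∷ S) zero    = refl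
    lookup-∈? (_ ∷ S)       (suc x) = lookup-∈? S x
    eq : ∀ x → lookup (A u) x ≡ does (blockOf x FinP.≟ u)
    eq x = trans (lookup-∈? (A u) x) (does-⇔ (∈-A u x) (x ∈? A u) (blockOf x FinP.≟ u))

  signature-blockOf : ∀ x → signature I? x ≡ s (blockOf x)
  signature-blockOf x = s-signature (blockOf x) (Equivalence.from (∈-A (blockOf x) x) refl)

  adjacent : Fin r → Fin r → Bool
  adjacent u v = does (nonempty? (s u ∩ s v))

  adjacent-sym : ∀ u v → adjacent u v ≡ adjacent v u
  adjacent-sym u v = cong (does ∘ nonempty?) (∩-comm (s u) (s v))

  adjacent-refl : (∀ x → Nonempty (signature I? x)) → ∀ u → adjacent u u ≡ true
  adjacent-refl nonempty u = dec-true (nonempty? (s u ∩ s u)) (l , x∈p∩q⁺ (l∈ , l∈))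
    where
    x = proj₁ (proj₁ (isBlock u))
    l = proj₁ (nonempty x)
    l∈ : l ∈ s u
    l∈ = subst (l ∈_) (s-signature u (proj₂ (proj₁ (isBlock u)))) (proj₂ (nonempty x))

  does-∉I : IsIdeal I → ∀ i j (i<j : i Fin.< j) → does (¬? (I? (root i j i<j))) ≡ adjacent (blockOf i) (blockOf j)
  does-∉I ideal i j i<j = trans
    (does-⇔ (∉I⇔signatures-meet I? ideal i j i<j) (¬? (I? (root i j i<j))) (nonempty? (signature I? i ∩ signature I? j)))
    (cong₂ (λ σ τ → does (nonempty? (σ ∩ τ))) (signature-blockOf i) (signature-blockOf j))

-- The set of monochromatic edges and its size

maybe-root? : ∀ {n} (f : Root n → ℕ) i j {k} → (∀ i<j → f (root i j i<j) ≡ k) →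
              maybe f 0 (root? (i , j)) ≡ (if does (i FinP.<? j) then k else 0)
maybe-root? f i j {k} eq with i FinP.<? j
... | yes i<j = trans (eq i<j) (sym (cong (if_then k else 0) (dec-true (i FinP.<? j) i<j)))
... | no  i≮j = sym (cong (if_then k else 0) (dec-false (i FinP.<? j) i≮j))

module _ {n : ℕ} {I : Pred (Root n) 0ℓ} (I? : Decidable I) {p} (x : Vec (Fin p) n) where
  private
    Monochromatic : Root n → Set
    Monochromatic α = lookup x (Root.i α) ≡ lookup x (Root.j α)
    mono? : Decidable Monochromatic
    mono? α = lookup x (Root.i α) FinP.≟ lookup x (Root.j α)
    K = complement I?

  monochromatic : Subset (length K)
  monochromatic = tabulate (λ l → does (mono? (List.lookup K l)))

  ⊆monochromatic : ∀ ℬ → ℬ ⊆ monochromatic ⇔ Respects (edges I? ℬ) x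
  ⊆monochromatic ℬ = mk⇔ to from
    where
    edge : Fin (length K) → Fin n × Fin n
    edge l = Root.i (List.lookup K l) , Root.j (List.lookup K l)
    ∈-mono : ∀ l → l ∈ monochromatic ⇔ Monochromatic (List.lookup K l)
    ∈-mono = ∈-tabulate (λ l → mono? (List.lookup K l))
    to : ℬ ⊆ monochromatic → Respects (edges I? ℬ) x
    to ℬ⊆ e with ∈-map⁻ edge e
    ... | l , l∈ , refl = Equivalence.to (∈-mono l) (ℬ⊆ (proj₂ (∈-filter⁻ (_∈? ℬ) {xs = allFin _} l∈)))
    from : Respects (edges I? ℬ) x → ℬ ⊆ monochromatic
    from resp {l} l∈ℬ = Equivalence.from (∈-mono l) (resp (∈-map⁺ edge (∈-filter⁺ (_∈? ℬ) (∈-allFin l) l∈ℬ)))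

  -- The list `K` arises from all pairs (i, j) by keeping those with i < j and then those outside
  -- `I`. Undoing both selections turns the size into a double sum, in which adjacency of blocks
  -- replaces the test for `I`.
  ∣monochromatic∣ : (P : AccordantPartition I?) → IsIdeal I →
    ∣ monochromatic ∣ ≡ ∑< (λ i j → 𝟙 (adjacent P (blockOf P i) (blockOf P j)) ℕ.* 𝟙 (does (lookup x i FinP.≟ lookup x j)))
  ∣monochromatic∣ P ideal = begin
    ∣ monochromatic ∣
      ≡⟨ ∣∣≡∑ monochromatic ⟩
    ∑ (λ l → 𝟙 (lookup monochromatic l))
      ≡⟨ ℕΣ.sum-cong-≗ (λ l → cong 𝟙 (VecP.lookup∘tabulate (λ l → does (mono? (List.lookup K l))) l)) ⟩
    ∑ (λ l → μ (List.lookup K l))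
      ≡⟨ Σ-lookup K μ ⟨
    Σ[ K ] μ
      ≡⟨ Σ-filter (∁? I?) (positiveRoots n) μ ⟩
    Σ[ positiveRoots n ] ν
      ≡⟨ Σ-mapMaybe root? (cartesianProduct (allFin n) (allFin n)) ν ⟩
    Σ[ cartesianProduct (allFin n) (allFin n) ] (maybe ν 0 ∘ root?)
      ≡⟨ Σ-cartesianProductWith _,_ (allFin n) (allFin n) (maybe ν 0 ∘ root?) ⟩
    Σ[ allFin n ] (λ i → Σ[ allFin n ] (λ j → maybe ν 0 (root? (i , j))))
      ≡⟨ Σ-allFin n _ ⟩
    ∑ (λ i → Σ[ allFin n ] (λ j → maybe ν 0 (root? (i , j))))
      ≡⟨ ℕΣ.sum-cong-≗ (λ i → trans (Σ-allFin n (λ j → maybe ν 0 (root? (i , j)))) (ℕΣ.sum-cong-≗ (entry i))) ⟩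
    ∑< pair ∎
    where
    open ListSum ℕP.+-0-commutativeMonoid
    μ ν : Root n → ℕ
    μ α = 𝟙 (does (mono? α))
    ν α = if does (¬? (I? α)) then μ α else 0
    pair : Fin n → Fin n → ℕ
    pair i j = 𝟙 (adjacent P (blockOf P i) (blockOf P j)) ℕ.* 𝟙 (does (lookup x i FinP.≟ lookup x j))
    if-𝟙 : ∀ b k → (if b then k else 0) ≡ 𝟙 b ℕ.* k
    if-𝟙 true  k = sym (ℕP.*-identityˡ k)
    if-𝟙 false k = refl
    entry : ∀ i j → maybe ν 0 (root? (i , j)) ≡ (if does (i FinP.<? j) then pair i j else 0)
    entry i j = maybe-root? ν i j λ i<j → trans (cong (if_then μ (root i j i<j) else 0) (does-∉I P ideal i j i<j))
      (if-𝟙 (adjacent P (blockOf P i) (blockOf P j)) (μ (root i j i<j)))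

  ∣monochromatic∣≡exponent : 2 ≤ n → IsIdeal I → HasFullComplement I → (P : AccordantPartition I?) →
    ∣ monochromatic ∣ ≡ exponent P (counts (blockOf P) x)
  ∣monochromatic∣≡exponent 2≤n ideal full P = trans (∣monochromatic∣ P ideal)
    (∑<-monochromatic (blockOf P) x (adjacent P)
      (adjacent-refl P (signature-nonempty 2≤n I? full)) (adjacent-sym P)
      (AccordantPartition.R P)
      (λ u v → VecP.lookup∘tabulate (λ v → does (u FinP.<? v) ∧ adjacent P u v) v))

-- The coboundary polynomial

-- `rep` is injective, having `class` as left inverse. The bound makes the truncated subtraction in
-- the rank exact.
componentCount-≤ : ∀ {n d} {edges : List (Fin n × Fin n)} → Components edges d → d ≤ n
componentCount-≤ G = FinP.injective⇒≤ {f = rep} λ {k} {l} eq →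
  trans (sym (class-rep k)) (trans (cong class eq) (class-rep l))
  where open Components G

componentCount-≥1 : ∀ {n d} {edges : List (Fin n × Fin n)} → 1 ≤ n → Components edges d → 1 ≤ d
componentCount-≥1 (s≤s _) G = ℕP.≤-trans (s≤s z≤n) (FinP.toℕ<n (Components.class G zero))

-- The whole arrangement has rank n - 1 and a subarrangement with `d` components has rank n - d;
-- this is the resulting exponent of q.
rank-difference : ∀ {n d} → d ≤ n → (n ∸ 1) ∸ (n ∸ d) ≡ d ∸ 1
rank-difference {n} {d} d≤n = begin
  n ∸ 1 ∸ (n ∸ d)    ≡⟨ ℕP.∸-+-assoc n 1 (n ∸ d) ⟩
  n ∸ (1 ℕ.+ (n ∸ d)) ≡⟨ cong (n ∸_) (ℕP.+-comm 1 (n ∸ d)) ⟩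
  n ∸ ((n ∸ d) ℕ.+ 1) ≡⟨ ℕP.∸-+-assoc n (n ∸ d) 1 ⟨
  n ∸ (n ∸ d) ∸ 1    ≡⟨ cong (_∸ 1) (ℕP.m∸[m∸n]≡n d≤n) ⟩
  d ∸ 1              ∎

module _ {n : ℕ} {I : Pred (Root n) 0ℓ} (I? : Decidable I) where

  ∈-edges-⊤ : ∀ {i j} (i<j : i Fin.< j) → ¬ I (root i j i<j) → (i , j) ∈ₗ edges I? ⊤
  ∈-edges-⊤ {i} {j} i<j ∉I = subst (λ α → (Root.i α , Root.j α) ∈ₗ edges I? ⊤) (sym (AnyP.lookup-index α∈))
    (∈-map⁺ edge (∈-filter⁺ (_∈? ⊤) (∈-allFin (Any.index α∈)) ∈⊤))
    where
    edge : Fin (length (complement I?)) → Fin n × Fin n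
    edge l = Root.i (List.lookup (complement I?) l) , Root.j (List.lookup (complement I?) l)
    α∈ : root i j i<j ∈ₗ complement I?
    α∈ = ∈-filter⁺ (∁? I?) (∈-positiveRoots (root i j i<j)) ∉I

-- The simple roots form a path through all indices, so every component is that of the first index.
full⇒connected : ∀ {n d} → 1 ≤ n → {I : Pred (Root n) 0ℓ} (I? : Decidable I) → HasFullComplement I →
                 Components (edges I? ⊤) d → d ≡ 1
full⇒connected 1≤n@(s≤s _) I? full G = ℕP.≤-antisym
  -- Since any two components coincide, even the constant map to a one-element set is injective,
  -- which bounds `d` by 1.
  (FinP.injective⇒≤ {f = λ _ → zero {0}} (λ {k} {l} _ → trans (k≡class₀ k) (sym (k≡class₀ l))))
  (componentCount-≥1 1≤n G)
  where
  open Components G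
  step : ∀ i → class (inject₁ i) ≡ class zero → class (suc i) ≡ class zero
  step i eq = trans (sym (respects (∈-edges-⊤ I? i<1+i (full (root _ _ i<1+i) (cong suc (sym (FinP.toℕ-inject₁ i))))))) eq
    where
    i<1+i : inject₁ i Fin.< suc i
    i<1+i = s≤s (ℕP.≤-reflexive (FinP.toℕ-inject₁ i))
  k≡class₀ : ∀ k → k ≡ class zero
  k≡class₀ k = trans (sym (class-rep k)) (<-weakInduction (λ i → class i ≡ class zero) refl step (rep k))

module _ where
  open import Data.Rational.Base using (_+_; _*_)
  open ListSum ℚP.+-0-commutativeMonoid
  open RawSemiringDefs (RawRing.rawSemiring ℚ[t]) using (_^_)

  module _ {n : ℕ} (2≤n : 2 ≤ n) {I : Pred (Root n) 0ℓ} (I? : Decidable I)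
           (ideal : IsIdeal I) (full : HasFullComplement I) (p : ℕ)
    where

    private
      m = length (complement I?)

      d : Subset m → ℕ
      d ℬ = proj₁ (components (edges I? ℬ))

      rank-exponent : ∀ ℬ → (n ∸ d ⊤) ∸ (n ∸ d ℬ) ≡ d ℬ ∸ 1
      rank-exponent ℬ = trans
        (cong (λ e → (n ∸ e) ∸ (n ∸ d ℬ)) (full⇒connected (ℕP.<⇒≤ 2≤n) I? full (proj₂ (components (edges I? ⊤)))))
        (rank-difference (componentCount-≤ (proj₂ (components (edges I? ℬ)))))

      -- This accounts for the factor 1/p in the theorem. The exponent is restored exactly because a
      -- graph on a nonempty vertex set has at least one component.
      power : ∀ ℬ → fromℕ p * fromℕ (p ℕ.^ (d ℬ ∸ 1)) ≡ fromℕ (p ℕ.^ d ℬ)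
      power ℬ = trans (sym (fromℕ-* p (p ℕ.^ (d ℬ ∸ 1)))) (cong (λ e → fromℕ (p ℕ.^ e))
        (ℕP.m+[n∸m]≡n (componentCount-≥1 (ℕP.<⇒≤ 2≤n) (proj₂ (components (edges I? ℬ))))))

    coefficient-coboundary : ∀ k →
      fromℕ p * coefficient (coboundary ℚ[t] (𝒜 I?) (constant (fromℕ p)) indeterminate) k ≡
      Σ[ colourings p n ] (λ x → coefficient (indeterminate ^ ∣ monochromatic I? x ∣) k)
    coefficient-coboundary k = begin
      fromℕ p * coefficient (coboundary ℚ[t] (𝒜 I?) (constant (fromℕ p)) indeterminate) k
        ≡⟨ cong (fromℕ p *_) (coefficient-sumOver (allSubsets m) _ k) ⟩
      fromℕ p * Σ[ allSubsets m ] (λ ℬ → coefficient (constant (fromℕ p) ^ ((n ∸ d ⊤) ∸ (n ∸ d ℬ)) *ᴾ t-1 ^ ∣ ℬ ∣) k)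
        ≡⟨ Σ-*ˡ (allSubsets m) (fromℕ p) _ ⟩
      Σ[ allSubsets m ] (λ ℬ → fromℕ p * coefficient (constant (fromℕ p) ^ ((n ∸ d ⊤) ∸ (n ∸ d ℬ)) *ᴾ t-1 ^ ∣ ℬ ∣) k)
        ≡⟨ Σ-cong (allSubsets m) (λ {ℬ} _ → term ℬ) ⟩
      Σ[ allSubsets m ] (λ ℬ → fromℕ (p ℕ.^ d ℬ) * c ℬ)
        ≡⟨ Σ-cong (allSubsets m) (λ {ℬ} _ → Σ-respecting (proj₂ (components (edges I? ℬ)))
             (λ x → ℬ ⊆? monochromatic I? x) (λ x → ⊆monochromatic I? x ℬ) (c ℬ)) ⟨
      Σ[ allSubsets m ] (λ ℬ → Σ[ colourings p n ] (λ x → if does (ℬ ⊆? monochromatic I? x) then c ℬ else 0ℚ))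
        ≡⟨ Σ-comm (allSubsets m) (colourings p n) (λ ℬ x → if does (ℬ ⊆? monochromatic I? x) then c ℬ else 0ℚ) ⟩
      Σ[ colourings p n ] (λ x → Σ[ allSubsets m ] (λ ℬ → if does (ℬ ⊆? monochromatic I? x) then c ℬ else 0ℚ))
        ≡⟨ Σ-cong (colourings p n) (λ {x} _ → Σ-subsets (monochromatic I? x) k) ⟩
      Σ[ colourings p n ] (λ x → coefficient (indeterminate ^ ∣ monochromatic I? x ∣) k) ∎
      where
      c : Subset m → ℚ
      c ℬ = coefficient (t-1 ^ ∣ ℬ ∣) k
      term : ∀ ℬ → fromℕ p * coefficient (constant (fromℕ p) ^ ((n ∸ d ⊤) ∸ (n ∸ d ℬ)) *ᴾ t-1 ^ ∣ ℬ ∣) k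
        ≡ fromℕ (p ℕ.^ d ℬ) * c ℬ
      term ℬ = begin
        fromℕ p * coefficient (constant (fromℕ p) ^ ((n ∸ d ⊤) ∸ (n ∸ d ℬ)) *ᴾ t-1 ^ ∣ ℬ ∣) k
          ≡⟨ cong (λ e → fromℕ p * coefficient (constant (fromℕ p) ^ e *ᴾ t-1 ^ ∣ ℬ ∣) k) (rank-exponent ℬ) ⟩
        fromℕ p * coefficient (constant (fromℕ p) ^ (d ℬ ∸ 1) *ᴾ t-1 ^ ∣ ℬ ∣) k
          ≡⟨ cong (λ f → fromℕ p * coefficient (f *ᴾ t-1 ^ ∣ ℬ ∣) k) (constant-^ p (d ℬ ∸ 1)) ⟩
        fromℕ p * coefficient (constant (fromℕ (p ℕ.^ (d ℬ ∸ 1))) *ᴾ t-1 ^ ∣ ℬ ∣) k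
          ≡⟨ cong (fromℕ p *_) (coefficient-constant-* (fromℕ (p ℕ.^ (d ℬ ∸ 1))) (t-1 ^ ∣ ℬ ∣) k) ⟩
        fromℕ p * (fromℕ (p ℕ.^ (d ℬ ∸ 1)) * c ℬ)
          ≡⟨ ℚP.*-assoc (fromℕ p) (fromℕ (p ℕ.^ (d ℬ ∸ 1))) (c ℬ) ⟨
        fromℕ p * fromℕ (p ℕ.^ (d ℬ ∸ 1)) * c ℬ
          ≡⟨ cong (_* c ℬ) (power ℬ) ⟩
        fromℕ (p ℕ.^ d ℬ) * c ℬ ∎

    coefficient-families : (P : AccordantPartition I?) → ∀ k →
      Σ[ colourings p n ] (λ x → coefficient (indeterminate ^ ∣ monochromatic I? x ∣) k) ≡
      coefficient (sumOver ℚ[t] (families p (λ u → ∣ AccordantPartition.A P u ∣))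
        (λ a → constant (fromℕ (multiplicity P a)) *ᴾ indeterminate ^ exponent P a)) k
    coefficient-families P k = begin
      Σ[ colourings p n ] (λ x → coefficient (indeterminate ^ ∣ monochromatic I? x ∣) k)
        ≡⟨ Σ-cong (colourings p n) (λ {x} _ → cong (λ e → coefficient (indeterminate ^ e) k)
             (∣monochromatic∣≡exponent I? x 2≤n ideal full P)) ⟩
      Σ[ colourings p n ] (f ∘ counts (blockOf P))
        ≡⟨ Σ-colourings-counts p (blockOf P) f ⟩
      weightedFamilySum p (fibreSize (blockOf P)) f
        ≡⟨ weightedFamilySum-cong p (∣A∣≡fibreSize P) (λ _ → refl) ⟨
      weightedFamilySum p (λ u → ∣ A u ∣) f
        ≡⟨ Σ-cong (families p (λ u → ∣ A u ∣)) (λ {a} _ →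
             coefficient-constant-* (fromℕ (multiplicity P a)) (indeterminate ^ exponent P a) k) ⟨
      Σ[ families p (λ u → ∣ A u ∣) ] (λ a → coefficient (constant (fromℕ (multiplicity P a)) *ᴾ indeterminate ^ exponent P a) k)
        ≡⟨ coefficient-sumOver (families p (λ u → ∣ A u ∣)) _ k ⟨
      _ ∎
      where
      open AccordantPartition P using (A; r)
      f : Vec (Vec ℕ p) r → ℚ
      f a = coefficient (indeterminate ^ exponent P a) k

open import Data.Integer.Base using (+_)

mainTheorem11 :
    ∀ (n : ℕ) → 2 ≤ n →
    (I : Pred (Root n) 0ℓ) (I? : Decidable I) → IsIdeal I → HasFullComplement I →
    (P : AccordantPartition I?) →
    (p : ℕ) (p-prime : Prime p) → ¬ (2 ∣ p) →
    let open RawRing ℚ[t]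
        open RawSemiringDefs rawSemiring using (_^_)
        open AccordantPartition P using (A)
        t = indeterminate
        1/p = (+ 1 / p) {{prime⇒nonZero p-prime}}
    in  coboundary ℚ[t] (𝒜 I?) (constant (fromℕ p)) t
        ≈ constant 1/p * sumOver ℚ[t] (families p (λ u → ∣ A u ∣)) (λ a →
            constant (fromℕ (multiplicity P a)) * t ^ exponent P a)
mainTheorem11 n 2≤n I I? ideal full P p p-prime _ k = begin
  lhs
    ≡⟨ ℚP.*-identityˡ lhs ⟨
  1ℚ * lhs
    ≡⟨ cong (_* lhs) (1/n*n≡1 p {{prime⇒nonZero p-prime}}) ⟨
  1/p * fromℕ p * lhs
    ≡⟨ ℚP.*-assoc 1/p (fromℕ p) lhs ⟩
  1/p * (fromℕ p * lhs)
    ≡⟨ cong (1/p *_) (trans (coefficient-coboundary 2≤n I? ideal full p k) (coefficient-families 2≤n I? ideal full p P k)) ⟩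
  1/p * coefficient rhs k
    ≡⟨ coefficient-constant-* 1/p rhs k ⟨
  coefficient (constant 1/p *ᴾ rhs) k ∎
  where
  open import Data.Rational.Base using (_*_)
  open RawSemiringDefs (RawRing.rawSemiring ℚ[t]) using (_^_)
  lhs = coefficient (coboundary ℚ[t] (𝒜 I?) (constant (fromℕ p)) indeterminate) k
  1/p = (+ 1 / p) {{prime⇒nonZero p-prime}}
  rhs = sumOver ℚ[t] (families p (λ u → ∣ AccordantPartition.A P u ∣))
          (λ a → constant (fromℕ (multiplicity P a)) *ᴾ indeterminate ^ exponent P a)
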